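{- If $k\geq 1$ and $\ell\in\{1,\ldots,2k+1\}$, then there are exactly $A_{k+1}(\ell)$ uniquely sorted permutations in $S_{2k+1}$ with eye $\ell-1$.
   Context: $S_n$ is the set of permutations of $\{1,\ldots,n\}$, written as words $\pi=\pi_1\cdots\pi_n$. The (West) stack-sorting map $s:S_n\to S_n$ is defined by the following procedure on an input $\pi=\pi_1\cdots\pi_n$, using an initially empty vertical stack. At any point in time, if there is a next entry of the input and either it is smaller than the entry at the top of the stack or the stack is empty, then that next entry is placed on top of the stack. Otherwise, the entry at the top of the stack is removed and appended to the end of the output. The procedure terminates when the output has length $n$, and $s(\pi)$ is this output. A permutation $\pi\in S_n$ is uniquely sorted if $|s^{ -1}(\pi)|=1$. $A_{k+1}(\ell)$ denotes the number of uniquely sorted permutations $\pi\in S_{2k+1}$ with first entry $\pi_1=\ell$. A descent of $\pi$ is an index $i\in\{1,\ldots,n-1\}$ with $\pi_i>\pi_{i+1}$. The plot of $\pi$ is the set of points $(i,\pi_i)$. A hook of $\pi$ is given by a southwest endpoint $(i,\pi_i)$ and a northeast endpoint $(j,\pi_j)$ with $i<j$ and $\pi_i<\pi_j$; it is the L-shaped set $(\{i\}\times[\pi_i,\pi_j])\cup([i,j]\times\{\pi_j\})$. If $\pi$ has descents $d_1<\cdots<d_k$, a valid hook configuration of $\pi$ is a tuple $(H_1,\ldots,H_k)$ of hooks of $\pi$ such that: (1) for each $i$, the southwest endpoint of $H_i$ is $(d_i,\pi_{d_i})$; (2) no point of the plot lies directly above a hook (i.e., if a hook has endpoints $(i,\pi_i)$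 and $(j,\pi_j)$ and $i<l<j$, then $\pi_l<\pi_j$); (3) hooks do not intersect each other, except that the northeast endpoint of one hook may be the southwest endpoint of another. Each uniquely sorted permutation $\pi\in S_{2k+1}$ has a unique valid hook configuration $\mathcal H$, and for $k\ge1$ it has at least one hook. The top hook of $\mathcal H$ is the hook whose northeast endpoint is farthest north. The sheltered piece of $\mathcal H$ consists of all points and hooks lying strictly underneath the top hook (so its points are the $(l,\pi_l)$ with $l$ strictly between the abscissas of the two endpoints of the top hook). If $(j,\pi_j)$ is the leftmost point in the sheltered piece, then $\pi_j$ is called the eye of $\pi$. -}

module Defs where

open import Data.Bool using (if_then_else_)
open import Data.Nat using (ℕ; zero; suc; _+_; _*_; _≤_; _<_; s≤s; _≟_; _<?_; _≤?_)
open import Data.Nat.Properties using (≤-refl; <⇒≤; 1+n≰n; allUpTo?)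
open import Data.Fin as Fin using (Fin; toℕ)
import Data.Fin.Properties as Fin
open import Data.List using (List; []; _∷_; [_]; _++_; map; concatMap; filter; length; lookup; head; allFin; downFrom)
import Data.List.Properties as List
open import Data.List.Relation.Unary.All as All using (All; []; _∷_; all?)
open import Data.List.Relation.Unary.Any using (Any; here; there; any?)
open import Data.List.Relation.Unary.AllPairs using (AllPairs; []; _∷_; allPairs?)
open import Data.List.Membership.Propositional using (_∈_; find; lose)
open import Data.List.Membership.Propositional.Properties
import Data.List.Relation.Unary.All.Properties as All
import Data.List.Relation.Unary.AllPairs.Properties as AP
open import Data.List.Relation.Unary.Unique.Propositional using (Unique)
open import Data.List.Relation.Binary.Disjoint.Propositional using (Disjoint)
import Data.List.Relation.Unary.Unique.Propositional.Properties as Unique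
open import Data.List.Relation.Binary.Permutation.Propositional using (_↭_; prep; swap; ↭-refl; ↭-sym; ↭-trans)
open import Data.List.Relation.Binary.Permutation.Propositional.Properties using (∈-resp-↭; drop-mid; All-resp-↭)
open import Function using (_∘_)
open import Data.Maybe using (just)
import Data.Maybe.Properties as Maybe
open import Data.Product using (∃-syntax; _×_; _,_)
open import Data.Sum using (_⊎_; inj₁; inj₂)
open import Relation.Binary.PropositionalEquality using (_≡_; _≢_; refl; sym; trans; cong)
open import Relation.Nullary using (Dec; does)
open import Relation.Nullary.Decidable using (map′; ¬?; _×-dec_; _⊎-dec_; _→-dec_)
open import Relation.Unary using (Pred; Decidable)
open import Level using (0ℓ)

Word : Set
Word = List ℕ

insertions : ℕ → Word → List Word
insertions x []       = [ x ∷ [] ]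
insertions x (y ∷ ys) = (x ∷ y ∷ ys) ∷ map (y ∷_) (insertions x ys)

-- S n lists every word π₁⋯πₙ that is a permutation of {1,…,n}, exactly once
-- (∈S⇒↭, ↭⇒∈S and S-unique below).
S : ℕ → List Word
S zero    = [ [] ]
S (suc n) = concatMap (insertions (suc n)) (S n)

insertions⇒↭ : ∀ {x w} v → w ∈ insertions x v → w ↭ x ∷ v
insertions⇒↭ []      (here refl) = ↭-refl
insertions⇒↭ (y ∷ v) (here refl) = ↭-refl
insertions⇒↭ (y ∷ v) (there w∈) with _ , u∈ , refl ← ∈-map⁻ (y ∷_) w∈ =
  ↭-trans (prep y (insertions⇒↭ v u∈)) (swap y _ ↭-refl)

∈-insertions : ∀ {x} u v → u ++ x ∷ v ∈ insertions x (u ++ v)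
∈-insertions []      []      = here refl
∈-insertions []      (y ∷ v) = here refl
∈-insertions (y ∷ u) v       = there (∈-map⁺ (y ∷_) (∈-insertions u v))

∈S⇒↭ : ∀ n {π} → π ∈ S n → π ↭ map suc (downFrom n)
∈S⇒↭ zero    (here refl) = ↭-refl
∈S⇒↭ (suc n) π∈ with σ , σ∈ , π∈σ ← find (∈-concatMap⁻ (insertions (suc n)) {xs = S n} π∈) =
  ↭-trans (insertions⇒↭ σ π∈σ) (prep _ (∈S⇒↭ n σ∈))

↭⇒∈S : ∀ n {π} → π ↭ map suc (downFrom n) → π ∈ S n
↭⇒∈S zero    {[]}    p = here refl
↭⇒∈S zero    {_ ∷ _} p with () ← ∈-resp-↭ p (here refl)
↭⇒∈S (suc n) p with u , v , refl ← ∈-∃++ (∈-resp-↭ (↭-sym p) (here refl)) =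
  ∈-concatMap⁺ (insertions (suc n)) (lose (↭⇒∈S n (drop-mid u [] p)) (∈-insertions u v))

delete : ℕ → Word → Word
delete x = filter (λ y → ¬? (y ≟ x))

delete-insertions : ∀ {x w} v → All (_≢ x) v → w ∈ insertions x v → delete x w ≡ v
delete-insertions {x} [] _ (here refl) = List.filter-reject (λ y → ¬? (y ≟ x)) (λ ¬e → ¬e refl)
delete-insertions {x} (y ∷ v) a (here refl) =
  trans (List.filter-reject (λ y → ¬? (y ≟ x)) (λ ¬e → ¬e refl)) (List.filter-all (λ z → ¬? (z ≟ x)) a)
delete-insertions {x} (y ∷ v) (y≢ ∷ a) (there w∈) with _ , u∈ , refl ← ∈-map⁻ (y ∷_) w∈ =
  trans (List.filter-accept (λ y → ¬? (y ≟ x)) y≢) (cong (y ∷_) (delete-insertions v a u∈))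

insertions-unique : ∀ {x} v → All (_≢ x) v → Unique (insertions x v)
insertions-unique [] _ = [] ∷ []
insertions-unique (y ∷ v) (y≢ ∷ a) =
  All.tabulate (λ w∈ e → y≢ (sym (heads w∈ e))) ∷ Unique.map⁺ List.∷-injectiveʳ (insertions-unique v a)
  where
  heads : ∀ {x w} → w ∈ map (y ∷_) (insertions x v) → x ∷ y ∷ v ≡ w → x ≡ y
  heads w∈ e with _ , _ , refl ← ∈-map⁻ (y ∷_) w∈ = List.∷-injectiveˡ e

fresh : ∀ n {π} → π ∈ S n → All (_≢ suc n) π
fresh n π∈ = All-resp-↭ (↭-sym (∈S⇒↭ n π∈)) (go n ≤-refl)
  where
  go : ∀ m → m ≤ n → All (_≢ suc n) (map suc (downFrom m))
  go zero    _   = []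
  go (suc m) m<n = (λ { refl → 1+n≰n m<n }) ∷ go m (<⇒≤ m<n)

S-unique : ∀ n → Unique (S n)
S-unique zero    = [] ∷ []
S-unique (suc n) = Unique.concat⁺
  (All.map⁺ (All.tabulate λ {σ} σ∈ → insertions-unique σ (fresh n σ∈)))
  (AP.map⁺ (disjoint (S n) (fresh n) (S-unique n)))
  where
  disjoint : ∀ l → (∀ {σ} → σ ∈ l → All (_≢ suc n) σ) → Unique l → AllPairs (λ σ τ → Disjoint (insertions (suc n) σ) (insertions (suc n) τ)) l
  disjoint [] f [] = []
  disjoint (σ ∷ l) f (σ∉ ∷ u) =
    All.tabulate (λ {τ} τ∈ (p , q) → All.lookup σ∉ τ∈
      (trans (sym (delete-insertions σ (f (here refl)) p)) (delete-insertions τ (f (there τ∈)) q)))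
    ∷ disjoint l (f ∘ there) u

-- The number of permutations in S n satisfying P.
count : ∀ {P : Pred Word 0ℓ} (n : ℕ) → Decidable P → ℕ
count n P? = length (filter P? (S n))

-- One step of the procedure per call; the arguments are the remaining input,
-- the stack (top first) and the output so far.
run : (input stack output : Word) → Word
run []       []       out = out
run []       (t ∷ st) out = run [] st (out ++ [ t ])
run (x ∷ xs) []       out = run xs [ x ] out
run (x ∷ xs) (t ∷ st) out =
  if does (x <? t) then run xs (x ∷ t ∷ st) out
                   else run (x ∷ xs) st (out ++ [ t ])

s : Word → Word
s π = run π [] []

-- |s⁻¹(π)| = 1, where s : S n → S n.
UniquelySorted : ℕ → Word → Set
UniquelySorted n π = count n (λ σ → List.≡-dec _≟_ (s σ) π) ≡ 1

uniquelySorted? : ∀ n → Decidable (UniquelySorted n)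
uniquelySorted? n π = count n (λ σ → List.≡-dec _≟_ (s σ) π) ≟ 1

FirstEntry : ℕ → Word → Set
FirstEntry ℓ π = head π ≡ just ℓ

firstEntry? : ∀ ℓ → Decidable (FirstEntry ℓ)
firstEntry? ℓ π = Maybe.≡-dec _≟_ (head π) (just ℓ)

-- A (k+1) ℓ counts in S (2k+1); the value at index 0 is a dummy.
A : ℕ → ℕ → ℕ
A zero    ℓ = 0
A (suc k) ℓ = count n (λ π → uniquelySorted? n π ×-dec firstEntry? ℓ π)
  where n = 2 * k + 1

-- Positions are elements of Fin (length π), so abscissas start at 0 rather than
-- at 1; every notion below is invariant under this shift.
module _ (π : Word) where

  Position : Set
  Position = Fin (length π)

  Descent : Position → Set
  Descent i = ∃[ j ] toℕ j ≡ suc (toℕ i) × lookup π j < lookup π i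

  descent? : Decidable Descent
  descent? i = Fin.any? λ j → (toℕ j ≟ suc (toℕ i)) ×-dec (lookup π j <? lookup π i)

  -- In increasing order.
  descents : List Position
  descents = filter descent? (allFin (length π))

  record Ends : Set where
    constructor ends
    field
      sw ne : Position

    bottom top : ℕ
    bottom = lookup π sw
    top    = lookup π ne

  open Ends

  IsHook : Ends → Set
  IsHook H = sw H Fin.< ne H × bottom H < top H

  isHook? : Decidable IsHook
  isHook? H = (sw H Fin.<? ne H) ×-dec (bottom H <? top H)

  -- The lattice points of ({i}×[πᵢ,πⱼ]) ∪ ([i,j]×{πⱼ}).
  OnHook : Ends → Position → ℕ → Set
  OnHook H x y = (x ≡ sw H × bottom H ≤ y × y ≤ top H)
               ⊎ (sw H Fin.≤ x × x Fin.≤ ne H × y ≡ top H)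

  onHook? : ∀ H x y → Dec (OnHook H x y)
  onHook? H x y = ((x Fin.≟ sw H) ×-dec (bottom H ≤? y) ×-dec (y ≤? top H))
            ⊎-dec ((sw H Fin.≤? x) ×-dec (x Fin.≤? ne H) ×-dec (y ≟ top H))

  NoPointAbove : Ends → Set
  NoPointAbove H = ∀ l → sw H Fin.< l → l Fin.< ne H → lookup π l < top H

  noPointAbove? : Decidable NoPointAbove
  noPointAbove? H = Fin.all? λ l →
    (sw H Fin.<? l) →-dec (l Fin.<? ne H) →-dec (lookup π l <? top H)

  -- (x , y) is the northeast endpoint of H and the southwest endpoint of H′.
  Joint : Ends → Ends → Position → ℕ → Set
  Joint H H′ x y = (x ≡ ne H × y ≡ top H) × (x ≡ sw H′ × y ≡ bottom H′)

  joint? : ∀ H H′ x y → Dec (Joint H H′ x y)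
  joint? H H′ x y = ((x Fin.≟ ne H) ×-dec (y ≟ top H))
              ×-dec ((x Fin.≟ sw H′) ×-dec (y ≟ bottom H′))

  -- Testing lattice points is enough: hooks are made of axis-parallel segments
  -- with lattice endpoints, so if two of them share any point of the plane other
  -- than a joint, then they also share such a lattice point.
  NonCrossing : Ends → Ends → Set
  NonCrossing H H′ = ∀ x y → OnHook H x y → OnHook H′ x y →
                     Joint H H′ x y ⊎ Joint H′ H x y

  -- A valid hook configuration (H₁,…,H_k), as the list of its hooks.
  record Valid (ℋ : List Ends) : Set where
    constructor valid
    field
      hooks        : All IsHook ℋ
      atDescents   : map sw ℋ ≡ descents
      noPointAbove : All NoPointAbove ℋ
      nonCrossing  : AllPairs NonCrossing ℋ

  TopHook : List Ends → Ends → Set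
  TopHook ℋ H = All (λ H′ → top H′ ≤ top H) ℋ

  Sheltered : Ends → Position → Set
  Sheltered H l = sw H Fin.< l × l Fin.< ne H

  LeftmostSheltered : Ends → Position → Set
  LeftmostSheltered H j = Sheltered H j × (∀ l → Sheltered H l → j Fin.≤ l)

  -- For uniquely sorted π the valid hook configuration, hence its top hook, is
  -- unique, so there is at most one e with HasEye e.
  HasEye : ℕ → Set
  HasEye e = ∃[ ℋ ] Valid ℋ ×
    Any (λ H → TopHook ℋ H × ∃[ j ] LeftmostSheltered H j × lookup π j ≡ e) ℋ

  sheltered? : ∀ H l → Dec (Sheltered H l)
  sheltered? H l = (sw H Fin.<? l) ×-dec (l Fin.<? ne H)

  onHook⇒≤top : ∀ H {x y} → OnHook H x y → y ≤ top H
  onHook⇒≤top H (inj₁ (_ , _ , y≤)) = y≤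
  onHook⇒≤top H (inj₂ (_ , _ , refl)) = ≤-refl

  nonCrossing? : ∀ H H′ → Dec (NonCrossing H H′)
  nonCrossing? H H′ = Fin.all? λ x →
    map′ (λ f y p q → f (s≤s (onHook⇒≤top H p)) p q) (λ f {y} _ → f y)
      (allUpTo? (λ y → onHook? H x y →-dec onHook? H′ x y →-dec
                       (joint? H H′ x y ⊎-dec joint? H′ H x y))
                (suc (top H)))

  valid? : Decidable Valid
  valid? ℋ = map′ (λ (a , b , c , d) → valid a b c d) (λ (valid a b c d) → a , b , c , d)
    (all? isHook? ℋ ×-dec List.≡-dec Fin._≟_ (map sw ℋ) descents ×-dec
     all? noPointAbove? ℋ ×-dec allPairs? nonCrossing? ℋ)

  -- Search over all lists of endpoint pairs with prescribed southwest endpoints.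
  search : ∀ {P : Pred (List Ends) 0ℓ} → Decidable P → ∀ ds → Dec (∃[ ℋ ] map sw ℋ ≡ ds × P ℋ)
  search P? [] = map′ (λ p → [] , refl , p) (λ { ([] , _ , p) → p }) (P? [])
  search P? (d ∷ ds) =
    map′ (λ { (j , ℋ , refl , p) → ends d j ∷ ℋ , refl , p })
         (λ { (ends _ j ∷ ℋ , refl , p) → j , ℋ , refl , p })
         (Fin.any? λ j → search (λ ℋ → P? (ends d j ∷ ℋ)) ds)

  hasEye? : Decidable HasEye
  hasEye? e = map′ (λ (ℋ , _ , p) → ℋ , p) (λ (ℋ , v , p) → ℋ , Valid.atDescents v , v , p)
    (search (λ ℋ → valid? ℋ ×-dec any? (λ H →
       all? (λ H′ → top H′ ≤? top H) ℋ ×-dec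
       Fin.any? (λ j → (sheltered? H j ×-dec Fin.all? (λ l → sheltered? H l →-dec (j Fin.≤? l)))
                       ×-dec (lookup π j ≟ e))) ℋ)
     descents)

{-# OPTIONS --safe #-}

-- A uniquely sorted word is the postorder of a decreasing full binary tree in
-- which every right subtree begins below the root of its left sibling, and such
-- a word determines its tree. In any other decreasing binary tree an only child
-- can change sides, or a left subtree can be hung below the first entry of its
-- sibling, without changing the postorder; such a tree also has too few descents
-- to share its postorder with a good one. The hook leaving the root of a left
-- subtree ends at the parent, so for a tree with subtrees a and b the eye is the
-- first entry of b.
--
-- Let (a, b) range over the pairs of good trees whose labels partition {1,…,2k},
-- write f for first entries and r for roots, and let N count pairs.
--   * Joining a and b below a new maximum shows A(ℓ) = N(f a = ℓ, f b < r a), and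
--     N(f b = w < r a) for the number of words with eye w.
--   * Removing the first leaf ℓ of a tree, with its sibling a, and relabelling
--     shows A(ℓ) = N(f a < ℓ ≤ f b, r a < f b).
-- By the second formula
--   A(w+1) − A(w) = N(f a = w, r a < f b) − N(f b = w, r a < f b),
-- and by the first one, since N(f a = w) = N(f b = w), the number of words with
-- eye w exceeds A(w) by the same amount.

module Submission where

open import Defs
open import Data.Nat using (ℕ; zero; suc; pred; _+_; _*_; _∸_; _≤_; _<_; _≟_; _<?_; _≤?_; z≤n; s≤s)
open import Data.Nat.Properties
open import Data.Nat.Solver using (module +-*-Solver)
open import Data.Bool using (if_then_else_; true; false)
open import Data.Fin as Fin using (Fin; toℕ; fromℕ<)
import Data.Fin.Properties as Fin
open import Data.List
  using (List; []; _∷_; [_]; _++_; _∷ʳ_; map; filter; length; lookup; head; foldl; allFin; downFrom;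
         cartesianProduct; cartesianProductWith)
import Data.List.Properties as List
open import Data.List.Relation.Unary.All as All using (All; []; _∷_)
import Data.List.Relation.Unary.All.Properties as All
open import Data.List.Relation.Unary.Any using (here; there)
open import Data.List.Relation.Unary.AllPairs as AP using (AllPairs; []; _∷_)
import Data.List.Relation.Unary.AllPairs.Properties as AP
open import Data.List.Relation.Unary.Unique.Propositional using (Unique)
import Data.List.Relation.Unary.Unique.Propositional.Properties as Unique
open import Relation.Binary.PropositionalEquality hiding ([_])
open import Data.List.Membership.Propositional using (_∈_; find; lose)
open import Data.List.Membership.Propositional.Properties
open import Data.List.Membership.Propositional.Properties.WithK using (unique∧set⇒bag)
open import Data.List.Relation.Binary.BagAndSetEquality using (∼bag⇒↭)
open import Data.List.Relation.Binary.Permutation.Propositional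
  using (_↭_; ↭-refl; ↭-sym; ↭-trans; ↭-prep; ↭-swap; ↭-reflexive; ↭⇒↭ₛ)
open import Data.List.Relation.Binary.Permutation.Propositional.Properties
  using (∈-resp-↭; All-resp-↭; ↭-length; ++⁺; ++-comm; drop-∷)
  renaming (map⁺ to ↭-map⁺)
open import Data.List.Relation.Binary.Permutation.Setoid.Properties (setoid ℕ) using (Unique-resp-↭)
open import Data.Maybe using (just)
import Data.Maybe.Properties as Maybe
open import Data.Product using (∃-syntax; _×_; _,_; proj₁; proj₂; map₂; swap; uncurry)
open import Data.Sum using (_⊎_; inj₁; inj₂; [_,_]′)
import Data.Sum as Sum
open import Data.Unit using (⊤; tt)
open import Function using (_∘_; _⇔_; mk⇔; Equivalence)
open import Relation.Nullary using (¬_; yes; no; contradiction; does)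
open import Relation.Nullary.Decidable using (_×-dec_; dec-true; dec-false; ¬?; map′)
open import Relation.Unary using (Decidable)
open import Relation.Binary.Definitions using (Tri; tri<; tri≈; tri>)

-- Good trees and their words

data Tree : Set where
  leaf : ℕ → Tree
  node : Tree → Tree → ℕ → Tree

word : Tree → Word
word (leaf x)     = [ x ]
word (node l r x) = word l ++ word r ++ [ x ]

root first : Tree → ℕ
root (leaf x)      = x
root (node _ _ x)  = x
first (leaf x)     = x
first (node l _ _) = first l

-- Labels decrease away from the root. The last condition puts a descent where the word of `l` meets
-- the word of `r`.
data Good : Tree → Set where
  leaf : ∀ {x} → Good (leaf x)
  node : ∀ {l r x} → Good l → Good r → root l < x → root r < x → first r < root l →
         Good (node l r x)

word-first : ∀ t → ∃[ w ] word t ≡ first t ∷ w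
word-first (leaf x) = [] , refl
word-first (node l r x) with w , e ← word-first l = w ++ word r ++ [ x ] , cong (_++ word r ++ [ x ]) e

word-root : ∀ t → ∃[ w ] word t ≡ w ∷ʳ root t
word-root (leaf x)     = [] , refl
word-root (node l r x) = word l ++ word r , sym (List.++-assoc (word l) (word r) [ x ])

first∈word : ∀ t → first t ∈ word t
first∈word t rewrite proj₂ (word-first t) = here refl

root∈word : ∀ t → root t ∈ word t
root∈word t rewrite proj₂ (word-root t) = ∈-++⁺ʳ _ (here refl)

head-word : ∀ t → head (word t) ≡ just (first t)
head-word t rewrite proj₂ (word-first t) = refl

word≤root : ∀ {t} → Good t → All (_≤ root t) (word t)
word≤root leaf = ≤-refl ∷ []
word≤root (node gl gr l< r< _) =
  All.++⁺ (All.map (λ p → <⇒≤ (≤-<-trans p l<)) (word≤root gl))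
    (All.++⁺ (All.map (λ p → <⇒≤ (≤-<-trans p r<)) (word≤root gr)) (≤-refl ∷ []))

first≤root : ∀ {t} → Good t → first t ≤ root t
first≤root {t} g = All.lookup (word≤root g) (first∈word t)

node-↭ : ∀ l r x → word (node l r x) ↭ x ∷ word l ++ word r
node-↭ l r x = ↭-trans (↭-reflexive (sym (List.++-assoc (word l) (word r) [ x ]))) (++-comm (word l ++ word r) [ x ])

-- An entry of the word of a good tree is a leaf exactly when it is the first entry
-- or lies below the preceding one, so the word can be parsed deterministically.
shiftReduce : List Tree → ℕ → List Tree
shiftReduce (b ∷ a ∷ st) x with x <? root b
... | yes _ = leaf x ∷ b ∷ a ∷ st
... | no  _ = node a b x ∷ st
shiftReduce st x = leaf x ∷ st

-- Under this condition an entry `x` opens a new leaf instead of closing the two topmost trees of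
-- the stack.
RootAbove : ℕ → List Tree → Set
RootAbove x []      = ⊤
RootAbove x (t ∷ _) = x < root t

shift-leaf : ∀ {x} st → RootAbove x st → shiftReduce st x ≡ leaf x ∷ st
shift-leaf []       _ = refl
shift-leaf (b ∷ []) _ = refl
shift-leaf {x} (b ∷ a ∷ st) x<b with x <? root b
... | yes _   = refl
... | no  x≮b = contradiction x<b x≮b

reduce-node : ∀ {x a b} st → root b < x → shiftReduce (b ∷ a ∷ st) x ≡ node a b x ∷ st
reduce-node {x} {a} {b} st b<x with x <? root b
... | yes x<b = contradiction x<b (<-asym b<x)
... | no  _   = refl

-- Induction on `t` over all stacks: once `l` lies on the stack, `first r < root l` is the invariant
-- that `r` requires, and the final label, being above `root r`, reduces.
parse-word : ∀ {t st} → Good t → RootAbove (first t) st → foldl shiftReduce st (word t) ≡ t ∷ st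
parse-word {st = st} leaf above = shift-leaf st above
parse-word {node l r x} {st} (node gl gr _ r<x r<l) above = begin
  foldl shiftReduce st (word l ++ word r ++ [ x ])
    ≡⟨ List.foldl-++ shiftReduce st (word l) _ ⟩
  foldl shiftReduce (foldl shiftReduce st (word l)) (word r ++ [ x ])
    ≡⟨ cong (λ st → foldl shiftReduce st (word r ++ [ x ])) (parse-word gl above) ⟩
  foldl shiftReduce (l ∷ st) (word r ++ [ x ])
    ≡⟨ List.foldl-++ shiftReduce (l ∷ st) (word r) [ x ] ⟩
  shiftReduce (foldl shiftReduce (l ∷ st) (word r)) x
    ≡⟨ cong (λ st → shiftReduce st x) (parse-word gr r<l) ⟩
  shiftReduce (r ∷ l ∷ st) x
    ≡⟨ reduce-node st r<x ⟩
  node l r x ∷ st ∎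
  where open ≡-Reasoning

word-injective : ∀ {t t′} → Good t → Good t′ → word t ≡ word t′ → t ≡ t′
word-injective g g′ e = List.∷-injectiveˡ
  (trans (sym (parse-word {st = []} g tt)) (trans (cong (foldl shiftReduce []) e) (parse-word g′ tt)))

-- Preimages under the stack-sorting map

AllPairs-++⁻ : ∀ {X : Set} {R : X → X → Set} xs {ys} → AllPairs R (xs ++ ys) →
               AllPairs R xs × AllPairs R ys × All (λ x → All (R x) ys) xs
AllPairs-++⁻ []       rs       = [] , rs , []
AllPairs-++⁻ (x ∷ xs) (r ∷ rs) with rxs , rys , rxy ← AllPairs-++⁻ xs rs =
  (All.++⁻ˡ xs r ∷ rxs) , rys , (All.++⁻ʳ xs r ∷ rxy)

-- Stack-sorting turns inorder into postorder

data BinTree : Set where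
  ∅   : BinTree
  bin : BinTree → ℕ → BinTree → BinTree

inorder postorder : BinTree → Word
inorder ∅             = []
inorder (bin l x r)   = inorder l ++ x ∷ inorder r
postorder ∅           = []
postorder (bin l x r) = postorder l ++ postorder r ++ [ x ]

data Decreasing : BinTree → Set where
  ∅   : Decreasing ∅
  bin : ∀ {l x r} → Decreasing l → Decreasing r →
        All (_< x) (inorder l) → All (_< x) (inorder r) → Decreasing (bin l x r)

postorder↭inorder : ∀ t → postorder t ↭ inorder t
postorder↭inorder ∅           = ↭-refl
postorder↭inorder (bin l x r) =
  ++⁺ (postorder↭inorder l) (↭-trans (++-comm (postorder r) [ x ]) (↭-prep x (postorder↭inorder r)))

All-inorder⇒postorder : ∀ {P : ℕ → Set} t → All P (inorder t) → All P (postorder t)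
All-inorder⇒postorder t = All-resp-↭ (↭-sym (postorder↭inorder t))

All-postorder⇒inorder : ∀ {P : ℕ → Set} t → All P (postorder t) → All P (inorder t)
All-postorder⇒inorder t = All-resp-↭ (postorder↭inorder t)

HeadAbove : Word → Word → Set
HeadAbove []      w = ⊤
HeadAbove (y ∷ _) w = All (_< y) w

headAbove-map : ∀ {v w} u → (∀ {y} → All (_< y) v → All (_< y) w) → HeadAbove u v → HeadAbove u w
headAbove-map []      f h = tt
headAbove-map (_ ∷ _) f h = f h

run-push : ∀ {x} xs st out → HeadAbove st [ x ] → run (x ∷ xs) st out ≡ run xs (x ∷ st) out
run-push xs []       out _        = refl
run-push {x} xs (z ∷ st) out (x<z ∷ _) rewrite dec-true (x <? z) x<z = refl

run-pop : ∀ {x} rest st out → HeadAbove rest [ x ] → run rest (x ∷ st) out ≡ run rest st (out ++ [ x ])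
run-pop []         st out _ = refl
run-pop {x} (y ∷ rest) st out (x<y ∷ _) rewrite dec-false (y <? x) (<-asym x<y) = refl

-- The bound on `st` lets every entry of `t` be pushed without disturbing the old stack. The bound
-- on `rest` makes the next input entry expel whatever is left of `t`.
run-inorder : ∀ {t} rest st out → Decreasing t → HeadAbove rest (inorder t) → HeadAbove st (inorder t) →
              run (inorder t ++ rest) st out ≡ run rest st (out ++ postorder t)
run-inorder rest st out ∅ _ _ = cong (run rest st) (sym (List.++-identityʳ out))
run-inorder {bin l x r} rest st out (bin dl dr l<x r<x) hr hs = begin
  run ((inorder l ++ x ∷ inorder r) ++ rest) st out
    ≡⟨ cong (λ w → run w st out) (List.++-assoc (inorder l) _ rest) ⟩
  run (inorder l ++ x ∷ inorder r ++ rest) st out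
    ≡⟨ run-inorder (x ∷ inorder r ++ rest) st out dl l<x (headAbove-map st (All.++⁻ˡ (inorder l)) hs) ⟩
  run (x ∷ inorder r ++ rest) st (out ++ postorder l)
    ≡⟨ run-push _ st _ (headAbove-map st mid hs) ⟩
  run (inorder r ++ rest) (x ∷ st) (out ++ postorder l)
    ≡⟨ run-inorder rest (x ∷ st) _ dr (headAbove-map rest (All.tail ∘ All.++⁻ʳ (inorder l)) hr) r<x ⟩
  run rest (x ∷ st) ((out ++ postorder l) ++ postorder r)
    ≡⟨ run-pop rest st _ (headAbove-map rest mid hr) ⟩
  run rest st (((out ++ postorder l) ++ postorder r) ++ [ x ])
    ≡⟨ cong (run rest st) (trans (List.++-assoc (out ++ postorder l) (postorder r) [ x ])
                                 (List.++-assoc out (postorder l) _)) ⟩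
  run rest st (out ++ postorder l ++ postorder r ++ [ x ]) ∎
  where
  open ≡-Reasoning
  mid : ∀ {y} → All (_< y) (inorder l ++ x ∷ inorder r) → All (_< y) [ x ]
  mid p = All.head (All.++⁻ʳ (inorder l) p) ∷ []

s-inorder : ∀ {t} → Decreasing t → s (inorder t) ≡ postorder t
s-inorder {t} d = trans (cong s (sym (List.++-identityʳ (inorder t)))) (run-inorder [] [] [] d tt tt)

-- Descends the left spine past all labels above `x`; the part of the spine that remains becomes the
-- right subtree of `x`.
cons-inorder : ∀ {t} x → Decreasing t → All (x ≢_) (inorder t) →
               ∃[ t′ ] Decreasing t′ × inorder t′ ≡ x ∷ inorder t
cons-inorder x ∅ _ = bin ∅ x ∅ , bin ∅ ∅ [] [] , refl
cons-inorder {bin l y r} x d@(bin dl dr l<y r<y) x∉ with <-cmp x y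
... | tri≈ _ x≡y _ = contradiction x≡y (All.head (All.++⁻ʳ (inorder l) x∉))
... | tri> _ _ y<x = bin ∅ x (bin l y r) ,
  bin ∅ d [] (All.++⁺ (All.map (λ p → <-trans p y<x) l<y) (y<x ∷ All.map (λ p → <-trans p y<x) r<y)) , refl
... | tri< x<y _ _ with l′ , dl′ , e ← cons-inorder x dl (All.++⁻ˡ (inorder l) x∉) =
  bin l′ y r , bin dl′ dr (subst (All (_< y)) (sym e) (x<y ∷ l<y)) r<y , cong (_++ y ∷ inorder r) e

unique⇒inorder : ∀ {σ} → Unique σ → ∃[ t ] Decreasing t × inorder t ≡ σ
unique⇒inorder [] = ∅ , ∅ , refl
unique⇒inorder (x∉ ∷ u) with t , d , refl ← unique⇒inorder u = cons-inorder _ d x∉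

-- Makes `a` the left subtree of the leaf that comes first in the postorder of `t`, reached by going
-- left where possible and right otherwise. The postorder of `a` is thereby merely prepended.
attach : BinTree → BinTree → BinTree
attach a ∅                       = a
attach a (bin ∅ x ∅)             = bin a x ∅
attach a (bin ∅ x r@(bin _ _ _)) = bin ∅ x (attach a r)
attach a (bin l@(bin _ _ _) x r) = bin (attach a l) x r

postorder-attach : ∀ a t → postorder (attach a t) ≡ postorder a ++ postorder t
postorder-attach a ∅                       = sym (List.++-identityʳ (postorder a))
postorder-attach a (bin ∅ x ∅)             = refl
postorder-attach a (bin ∅ x r@(bin _ _ _)) =
  trans (cong (_++ [ x ]) (postorder-attach a r)) (List.++-assoc (postorder a) _ _)
postorder-attach a (bin l@(bin _ _ _) x r) =
  trans (cong (_++ postorder r ++ [ x ]) (postorder-attach a l)) (List.++-assoc (postorder a) _ _)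

attach-above : ∀ {z} a t → All (_< z) (inorder a) → All (_< z) (inorder t) → All (_< z) (inorder (attach a t))
attach-above a t pa pt = All-postorder⇒inorder (attach a t)
  (subst (All _) (sym (postorder-attach a t)) (All.++⁺ (All-inorder⇒postorder a pa) (All-inorder⇒postorder t pt)))

-- The first entry of the postorder is at most the root, so the bound passes on to the root.
headAbove⇒root : ∀ {l x r w} → Decreasing (bin l x r) → HeadAbove (postorder (bin l x r)) w → All (_< x) w
headAbove⇒root {l} {x} {r} (bin _ _ l<x r<x) h
  with postorder l | All-inorder⇒postorder l l<x | postorder r | All-inorder⇒postorder r r<x
... | []    | _       | []    | _       = h
... | []    | _       | _ ∷ _ | y<x ∷ _ = All.map (λ p → <-trans p y<x) h
... | _ ∷ _ | y<x ∷ _ | _     | _       = All.map (λ p → <-trans p y<x) h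

headAbove-++ : ∀ u {v w} → HeadAbove (u ++ v) w → HeadAbove u w
headAbove-++ []      h = tt
headAbove-++ (_ ∷ _) h = h

attach-decreasing : ∀ {a t} → Decreasing a → Decreasing t → HeadAbove (postorder t) (inorder a) →
                    Decreasing (attach a t)
attach-decreasing {t = ∅} da ∅ h = da
attach-decreasing {t = bin ∅ x ∅} da (bin _ _ _ _) h = bin da ∅ h []
attach-decreasing {a} {bin ∅ x r@(bin _ _ _)} da d@(bin _ dr _ r<x) h =
  bin ∅ (attach-decreasing da dr (headAbove-++ (postorder r) h)) [] (attach-above a r (headAbove⇒root d h) r<x)
attach-decreasing {a} {bin l@(bin _ _ _) x r} da d@(bin dl dr l<x r<x) h =
  bin (attach-decreasing da dl (headAbove-++ (postorder l) h)) dr (attach-above a l (headAbove⇒root d h) l<x) r<x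

-- Descents and word length

drop : ℕ → ℕ → ℕ
drop x y = if does (y <? x) then 1 else 0

descentCount : Word → ℕ
descentCount []          = 0
descentCount (x ∷ [])    = 0
descentCount (x ∷ y ∷ w) = drop x y + descentCount (y ∷ w)

drop≤1 : ∀ x y → drop x y ≤ 1
drop≤1 x y with does (y <? x)
... | true  = ≤-refl
... | false = z≤n

drop-descent : ∀ {x y} → y < x → drop x y ≡ 1
drop-descent {x} {y} y<x rewrite dec-true (y <? x) y<x = refl

drop-ascent : ∀ {x y} → x < y → drop x y ≡ 0
drop-ascent {x} {y} x<y rewrite dec-false (y <? x) (<-asym x<y) = refl

descentCount-++ : ∀ u {a b v} →
  descentCount (u ∷ʳ a ++ b ∷ v) ≡ descentCount (u ∷ʳ a) + (drop a b + descentCount (b ∷ v))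
descentCount-++ []          = refl
descentCount-++ (x ∷ [])    = cong₂ _+_ (sym (+-identityʳ (drop x _))) refl
descentCount-++ (x ∷ y ∷ u) = trans (cong (drop x y +_) (descentCount-++ (y ∷ u))) (sym (+-assoc (drop x y) _ _))

descentCount-∷ʳ : ∀ {w x} → All (_< x) w → descentCount (w ∷ʳ x) ≡ descentCount w
descentCount-∷ʳ []                = refl
descentCount-∷ʳ (y<x ∷ [])        = trans (+-identityʳ _) (drop-ascent y<x)
descentCount-∷ʳ {y ∷ _} (_ ∷ p@(_ ∷ _)) = cong (drop y _ +_) (descentCount-∷ʳ p)

-- The closing `x` exceeds everything before it and adds no descent; apart from those of `u` and
-- `v`, only the junction of `a` and `b` can be one.
descentCount-join : ∀ {u v x a u′ b v′} → u ≡ u′ ∷ʳ a → v ≡ b ∷ v′ → All (_< x) u → All (_< x) v →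
                    descentCount (u ++ v ++ [ x ]) ≡ descentCount u + (drop a b + descentCount v)
descentCount-join {x = x} {a} {u′} {b} {v′} refl refl pu pv = begin
  descentCount (u′ ∷ʳ a ++ b ∷ v′ ++ [ x ])                     ≡⟨ descentCount-++ u′ ⟩
  descentCount (u′ ∷ʳ a) + (drop a b + descentCount (b ∷ v′ ++ [ x ]))
    ≡⟨ cong (λ d → descentCount (u′ ∷ʳ a) + (drop a b + d)) (descentCount-∷ʳ pv) ⟩
  descentCount (u′ ∷ʳ a) + (drop a b + descentCount (b ∷ v′))   ∎
  where open ≡-Reasoning

word<above-root : ∀ {t x} → Good t → root t < x → All (_< x) (word t)
word<above-root g r<x = All.map (λ p → ≤-<-trans p r<x) (word≤root g)

length-join : ∀ (u v : Word) x → length (u ++ v ++ [ x ]) ≡ suc (length u + length v)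
length-join u v x = begin
  length (u ++ v ++ [ x ])          ≡⟨ List.length-++ u ⟩
  length u + length (v ++ [ x ])    ≡⟨ cong (length u +_) (trans (List.length-++ v) (+-comm (length v) 1)) ⟩
  length u + suc (length v)         ≡⟨ +-suc (length u) (length v) ⟩
  suc (length u + length v)         ∎
  where open ≡-Reasoning

double-join : ∀ m n → suc (2 * m) + suc (2 * n) ≡ 2 * (m + (1 + n))
double-join = solve 2 (λ m n → con 1 :+ con 2 :* m :+ (con 1 :+ con 2 :* n) := con 2 :* (m :+ (con 1 :+ n))) refl
  where open +-*-Solver

-- Each internal node contributes exactly one descent, at the junction of its subtrees, and a full
-- binary tree with d internal nodes has 2d+1 nodes.
length-word : ∀ {t} → Good t → length (word t) ≡ suc (2 * descentCount (word t))
length-word leaf = refl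
length-word {node l r x} (node gl gr l<x r<x r<l) = begin
  length (word (node l r x))                    ≡⟨ length-join (word l) (word r) x ⟩
  suc (length (word l) + length (word r))       ≡⟨ cong suc (cong₂ _+_ (length-word gl) (length-word gr)) ⟩
  suc (suc (2 * dl) + suc (2 * dr))             ≡⟨ cong suc (double-join dl dr) ⟩
  suc (2 * (dl + (1 + dr)))                     ≡⟨ cong (λ d → suc (2 * (dl + (d + dr)))) (drop-descent r<l) ⟨
  suc (2 * (dl + (drop (root l) (first r) + dr)))
    ≡⟨ cong (λ d → suc (2 * d)) (descentCount-join (proj₂ (word-root l)) (proj₂ (word-first r))
         (word<above-root gl l<x) (word<above-root gr r<x)) ⟨
  suc (2 * descentCount (word (node l r x)))    ∎
  where
  open ≡-Reasoning
  dl dr : ℕ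
  dl = descentCount (word l)
  dr = descentCount (word r)

-- Every nonempty decreasing tree is good or has an ambiguous postorder

embed : Tree → BinTree
embed (leaf x)     = bin ∅ x ∅
embed (node l r x) = bin (embed l) x (embed r)

postorder-embed : ∀ t → postorder (embed t) ≡ word t
postorder-embed (leaf x)     = refl
postorder-embed (node l r x) = cong₂ (λ u v → u ++ v ++ [ x ]) (postorder-embed l) (postorder-embed r)

embed-decreasing : ∀ {t} → Good t → Decreasing (embed t)
embed-decreasing leaf = bin ∅ ∅ [] []
embed-decreasing {node l r x} (node gl gr l<x r<x _) =
  bin (embed-decreasing gl) (embed-decreasing gr) (above gl l<x) (above gr r<x)
  where
  above : ∀ {t} → Good t → root t < x → All (_< x) (inorder (embed t))
  above {t} g t<x = All-postorder⇒inorder (embed t) (subst (All _) (sym (postorder-embed t)) (word<above-root g t<x))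

word≡postorder : ∀ {g} t → embed t ≡ g → word t ≡ postorder g
word≡postorder t refl = sym (postorder-embed t)

Full : BinTree → Set
Full g = ∃[ t ] Good t × embed t ≡ g

-- By `s-inorder`, the inorder of `g′` is a second preimage of the postorder of `g`.
AmbiguousPostorder : BinTree → Set
AmbiguousPostorder g = ∃[ g′ ] Decreasing g′ × postorder g′ ≡ postorder g × inorder g′ ≢ inorder g

FewDescents : BinTree → Set
FewDescents g = suc (2 * descentCount (postorder g)) < length (postorder g)

-- `ambiguous` keeps the postorder from being uniquely sorted; `few` keeps it from being the word of
-- a good tree, in view of `length-word`.
record Slack (g : BinTree) : Set where
  constructor slack
  field
    few       : FewDescents g
    ambiguous : AmbiguousPostorder g

full-length : ∀ {g} → Full g → length (postorder g) ≡ suc (2 * descentCount (postorder g))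
full-length (t , gt , refl) rewrite postorder-embed t = length-word gt

few-descents-≤ : ∀ {g} → Full g ⊎ Slack g → suc (2 * descentCount (postorder g)) ≤ length (postorder g)
few-descents-≤ (inj₁ f)           = ≤-reflexive (sym (full-length f))
few-descents-≤ (inj₂ (slack f _)) = <⇒≤ f

∷ʳ≢∷ : ∀ {x : ℕ} w → w ≢ [] → All (_< x) w → w ∷ʳ x ≢ x ∷ w
∷ʳ≢∷ []      w≢[] _         e = w≢[] refl
∷ʳ≢∷ (y ∷ w) _    (y<x ∷ _) e = <⇒≢ y<x (List.∷-injectiveˡ e)

-- A node with an only child lengthens the word without adding a descent, which makes the inequality
-- strict.
few-∷ʳ : ∀ {w x} → All (_< x) w → suc (2 * descentCount w) ≤ length w →
         suc (2 * descentCount (w ∷ʳ x)) < length (w ∷ʳ x)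
few-∷ʳ {w} {x} w<x p = subst₂ (λ d n → suc (2 * d) < n)
  (sym (descentCount-∷ʳ w<x)) (sym (trans (List.length-++ w) (+-comm (length w) 1))) (s≤s p)

postorder-nonempty : ∀ {t} → t ≢ ∅ → postorder t ≢ []
postorder-nonempty {∅}         t≢∅ _ = t≢∅ refl
postorder-nonempty {bin l x r} _   e with () ← List.++-conicalʳ (postorder r) [ x ] (List.++-conicalʳ (postorder l) _ e)

inorder-nonempty : ∀ l x r → inorder (bin l x r) ≢ []
inorder-nonempty l x r e with () ← List.++-conicalʳ (inorder l) _ e

last-of : ∀ (w : Word) → w ≢ [] → ∃[ u ] ∃[ a ] w ≡ u ∷ʳ a
last-of []          w≢[] = contradiction refl w≢[]
last-of (x ∷ [])    _    = [] , x , refl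
last-of (x ∷ y ∷ w) _ with u , a , e ← last-of (y ∷ w) (λ ()) = x ∷ u , a , cong (x ∷_) e

head-of : ∀ (w : Word) → w ≢ [] → ∃[ a ] ∃[ u ] w ≡ a ∷ u
head-of []      w≢[] = contradiction refl w≢[]
head-of (x ∷ w) _    = x , w , refl

module _ {l x r} (d : Decreasing (bin l x r)) where

  private
    u v : Word
    u = postorder l
    v = postorder r

    du dv : ℕ
    du = descentCount u
    dv = descentCount v

    few-if : ∀ {a b u′ v′} → Decreasing (bin l x r) → u ≡ u′ ∷ʳ a → v ≡ b ∷ v′ →
             suc (2 * (du + (drop a b + dv))) ≤ length u + length v → FewDescents (bin l x r)
    few-if (bin _ _ l<x r<x) eu ev p = subst₂ (λ d n → suc (2 * d) < n)
      (sym (descentCount-join eu ev (All-inorder⇒postorder l l<x) (All-inorder⇒postorder r r<x)))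
      (sym (length-join u v x)) (s≤s p)

  -- The outer `suc` in the hypothesis is the spare unit of a slack subtree; with it the bound
  -- survives even a descent at the junction.
  few-bin-slack : l ≢ ∅ → r ≢ ∅ → suc (suc (2 * du) + suc (2 * dv)) ≤ length u + length v →
                  FewDescents (bin l x r)
  few-bin-slack l≢∅ r≢∅ p
    with _ , a , eu ← last-of u (postorder-nonempty l≢∅) | b , _ , ev ← head-of v (postorder-nonempty r≢∅) =
    few-if d eu ev (begin
      suc (2 * (du + (drop a b + dv)))  ≤⟨ s≤s (*-monoʳ-≤ 2 (+-monoʳ-≤ du (+-monoˡ-≤ dv (drop≤1 a b)))) ⟩
      suc (2 * (du + (1 + dv)))         ≡⟨ cong suc (double-join du dv) ⟨
      suc (suc (2 * du) + suc (2 * dv)) ≤⟨ p ⟩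
      length u + length v               ∎)
    where open ≤-Reasoning

  -- The junction is an ascent, so the new node adds no descent and neither subtree has to be slack.
  few-bin-ascent : ∀ {a b u′ v′} → u ≡ u′ ∷ʳ a → v ≡ b ∷ v′ → a < b →
                   suc (2 * du) + suc (2 * dv) ≤ length u + length v → FewDescents (bin l x r)
  few-bin-ascent {a} {b} eu ev a<b p = few-if d eu ev (begin
      suc (2 * (du + (drop a b + dv)))  ≡⟨ cong (λ d → suc (2 * (du + (d + dv)))) (drop-ascent a<b) ⟩
      suc (2 * (du + dv))               ≡⟨ cong suc (*-distribˡ-+ 2 du dv) ⟩
      suc (2 * du) + 2 * dv             ≤⟨ +-monoʳ-≤ (suc (2 * du)) (n≤1+n _) ⟩
      suc (2 * du) + suc (2 * dv)       ≤⟨ p ⟩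
      length u + length v               ∎)
    where open ≤-Reasoning

classify : ∀ {g} → Decreasing g → Unique (postorder g) → g ≢ ∅ → Full g ⊎ Slack g
classify ∅ _ g≢∅ = contradiction refl g≢∅
classify {bin ∅ x ∅} _ _ _ = inj₁ (leaf x , leaf , refl)
-- An only child changes sides: the postorder stays, while `x` moves from one end of the inorder to
-- the other.
classify {bin ∅ x r@(bin l₂ y r₂)} (bin _ dr _ r<x) u _ with ur , _ ← AllPairs-++⁻ (postorder r) u =
  inj₂ (slack (few-∷ʳ (All-inorder⇒postorder r r<x) (few-descents-≤ (classify dr ur λ ())))
    (bin r x ∅ , bin dr ∅ r<x [] , refl , ∷ʳ≢∷ (inorder r) (inorder-nonempty l₂ y r₂) r<x))
classify {bin l@(bin l₂ y r₂) x ∅} (bin dl _ l<x _) u _ with ul , _ ← AllPairs-++⁻ (postorder l) u =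
  inj₂ (slack (few-∷ʳ (All-inorder⇒postorder l l<x) (few-descents-≤ (classify dl ul λ ())))
    (bin ∅ x l , bin ∅ dl [] l<x , refl , ∷ʳ≢∷ (inorder l) (inorder-nonempty l₂ y r₂) l<x ∘ sym))
classify {bin l@(bin l₁ y l₂) x r@(bin _ _ _)} d@(bin dl dr l<x r<x) u _
  with ul , uvx , disj ← AllPairs-++⁻ (postorder l) u
  with uv , _ ← AllPairs-++⁻ (postorder r) uvx
  with classify dl ul (λ ()) | classify dr uv (λ ())
-- A slack subtree is exchanged for its alternative; cancelling the common part of the inorders
-- shows that the whole trees still differ.
... | inj₂ (slack f (l′ , dl′ , el , ≢l)) | cr = inj₂ (slack
  (few-bin-slack d (λ ()) (λ ()) (+-mono-≤ f (few-descents-≤ cr)))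
  (bin l′ x r , bin dl′ dr (All-postorder⇒inorder l′ (subst (All _) (sym el) (All-inorder⇒postorder l l<x))) r<x ,
    cong (_++ postorder r ++ [ x ]) el , ≢l ∘ List.++-cancelʳ (x ∷ inorder r) (inorder l′) (inorder l)))
... | cl@(inj₁ _) | inj₂ (slack f (r′ , dr′ , er , ≢r)) = inj₂ (slack
  (few-bin-slack d (λ ()) (λ ())
    (≤-trans (≤-reflexive (sym (+-suc (suc (2 * descentCount (postorder l))) _))) (+-mono-≤ (few-descents-≤ cl) f)))
  (bin l x r′ , bin dl dr′ l<x (All-postorder⇒inorder r′ (subst (All _) (sym er) (All-inorder⇒postorder r r<x))) ,
    cong (λ v → postorder l ++ v ++ [ x ]) er , ≢r ∘ List.∷-injectiveʳ ∘ List.++-cancelˡ (inorder l) _ _))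
... | inj₁ fl@(tl , gl , el) | inj₁ fr@(tr , gr , er) with <-cmp (root tl) (first tr)
...   | tri> _ _ desc =
  inj₁ (node tl tr x , node gl gr (root< tl el l<x) (root< tr er r<x) desc , cong₂ (λ a b → bin a x b) el er)
  where
  root< : ∀ {g} t → embed t ≡ g → All (_< x) (inorder g) → root t < x
  root< t refl p = All.lookup (All-inorder⇒postorder (embed t) p)
    (subst (root t ∈_) (sym (postorder-embed t)) (root∈word t))
...   | tri≈ _ eq _ = contradiction eq (All.lookup (All.lookup disj (subst (root tl ∈_) (word≡postorder tl el) (root∈word tl)))
        (∈-++⁺ˡ (subst (first tr ∈_) (word≡postorder tr er) (first∈word tr))))
-- Hanging `l` inside `r` leaves `x` without a left child. The new inorder begins with `x`, the old
-- one with an entry of `l`, which is smaller.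
...   | tri< asc _ _ = inj₂ (slack
  (few-bin-ascent d
    (trans (sym (word≡postorder tl el)) (proj₂ (word-root tl))) (trans (sym (word≡postorder tr er)) (proj₂ (word-first tr))) asc
    (+-mono-≤ (few-descents-≤ (inj₁ fl)) (few-descents-≤ (inj₁ fr))))
  (bin ∅ x (attach l r) ,
   bin ∅ (attach-decreasing dl dr above) [] (attach-above l r l<x r<x) ,
   trans (cong (_++ [ x ]) (postorder-attach l r)) (List.++-assoc (postorder l) _ _) ,
   differ (inorder l) (inorder-nonempty l₁ y l₂) l<x))
  where
  above : HeadAbove (postorder r) (inorder l)
  above = subst (λ w → HeadAbove w (inorder l)) (trans (sym (proj₂ (word-first tr))) (word≡postorder tr er))
    (All-postorder⇒inorder l (subst (All _) (word≡postorder tl el) (word<above-root gl asc)))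
  differ : ∀ {u v : Word} w → w ≢ [] → All (_< x) w → x ∷ u ≢ w ++ x ∷ v
  differ []      w≢[] _         _ = w≢[] refl
  differ (_ ∷ _) _    (y<x ∷ _) e = <⇒≢ y<x (sym (List.∷-injectiveˡ e))

unique-resp-↭ : ∀ {v w : Word} → v ↭ w → Unique v → Unique w
unique-resp-↭ p = Unique-resp-↭ (↭⇒↭ₛ p)

S⇒unique : ∀ {n π} → π ∈ S n → Unique π
S⇒unique {n} π∈ = unique-resp-↭ (↭-sym (∈S⇒↭ n π∈)) (Unique.map⁺ suc-injective (Unique.downFrom⁺ n))

∈S-resp-↭ : ∀ {n π σ} → π ↭ σ → π ∈ S n → σ ∈ S n
∈S-resp-↭ {n} p π∈ = ↭⇒∈S n (↭-trans (↭-sym p) (∈S⇒↭ n π∈))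

word-nonempty : ∀ t → word t ≢ []
word-nonempty t e with () ← trans (sym (proj₂ (word-first t))) e

-- A slack `g` would give the word too few descents for its length, so `g` comes from a good tree,
-- and that tree is determined by its word.
postorder-word-unique : ∀ {t g} → Good t → Decreasing g → Unique (word t) → postorder g ≡ word t → g ≡ embed t
postorder-word-unique {t} gt dg u e with classify dg (subst Unique (sym e) u) (λ { refl → word-nonempty t (sym e) })
... | inj₁ (t′ , gt′ , refl) = cong embed (word-injective gt′ gt (trans (sym (postorder-embed t′)) e))
... | inj₂ (slack few _) = contradiction (sym (length-word gt)) (<⇒≢ (subst (λ w → suc (2 * descentCount w) < length w) e few))

length≡1⇒singleton : ∀ {X : Set} (xs : List X) → length xs ≡ 1 → ∃[ x ] xs ≡ [ x ]
length≡1⇒singleton (x ∷ []) _ = x , refl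

singleton⇒length≡1 : ∀ {X : Set} {x} {xs : List X} → Unique xs → x ∈ xs → (∀ {y} → y ∈ xs → y ≡ x) → length xs ≡ 1
singleton⇒length≡1 {xs = y ∷ []}     _             _ _ = refl
singleton⇒length≡1 {xs = y ∷ z ∷ xs} ((y≢z ∷ _) ∷ _) _ f = contradiction (trans (f (here refl)) (sym (f (there (here refl))))) y≢z

-- Uniquely sorted words are the words of good trees

module _ {n π} (π∈ : π ∈ S n) where

  private
    preimage? : Decidable (λ σ → s σ ≡ π)
    preimage? σ = List.≡-dec _≟_ (s σ) π

    inorder∈preimages : ∀ {g} → Decreasing g → postorder g ≡ π → inorder g ∈ filter preimage? (S n)
    inorder∈preimages {g} d e = ∈-filter⁺ preimage?
      (∈S-resp-↭ {n} (subst (_↭ inorder g) e (postorder↭inorder g)) π∈) (trans (s-inorder d) e)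

    preimages⇒inorder : ∀ {σ} → σ ∈ filter preimage? (S n) → ∃[ g ] Decreasing g × inorder g ≡ σ × postorder g ≡ π
    preimages⇒inorder σ∈ with σ∈S , sσ≡π ← ∈-filter⁻ preimage? {xs = S n} σ∈
      with g , d , refl ← unique⇒inorder (S⇒unique {n} σ∈S) = g , d , refl , trans (sym (s-inorder d)) sσ≡π

  -- The only preimage is the inorder of a decreasing tree. If that tree were slack, its alternative
  -- would yield a second preimage.
  uniquelySorted⇒good : π ≢ [] → UniquelySorted n π → ∃[ t ] Good t × word t ≡ π
  uniquelySorted⇒good π≢[] us with σ , e ← length≡1⇒singleton (filter preimage? (S n)) us
    with g , d , refl , post ← preimages⇒inorder (subst (σ ∈_) (sym e) (here refl))
    with classify d (subst Unique (sym post) (S⇒unique {n} π∈)) (λ { refl → π≢[] (sym post) })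
  ... | inj₁ (t , gt , refl) = t , gt , trans (sym (postorder-embed t)) post
  ... | inj₂ (slack _ (g′ , d′ , eq , g′≢g)) with here i≡ ← subst (inorder g′ ∈_) e (inorder∈preimages d′ (trans eq post)) =
    contradiction i≡ g′≢g

  good⇒uniquelySorted : ∀ {t} → Good t → word t ≡ π → UniquelySorted n π
  good⇒uniquelySorted {t} gt refl = singleton⇒length≡1 (Unique.filter⁺ preimage? (S-unique n))
    (inorder∈preimages (embed-decreasing gt) (postorder-embed t))
    (λ σ∈ → only (preimages⇒inorder σ∈))
    where
    only : ∀ {σ} → ∃[ g ] Decreasing g × inorder g ≡ σ × postorder g ≡ π → σ ≡ inorder (embed t)
    only (g , d , refl , e) = cong inorder (postorder-word-unique gt d (S⇒unique {n} π∈) e)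

-- Hook configurations

-- A total variant of `lookup`, with default value 0 past the end, so that positions can be plain
-- numbers.
at : Word → ℕ → ℕ
at []      _       = 0
at (x ∷ _) zero    = x
at (_ ∷ w) (suc i) = at w i

lookup≡at : ∀ w i → lookup w i ≡ at w (toℕ i)
lookup≡at (x ∷ w) Fin.zero    = refl
lookup≡at (x ∷ w) (Fin.suc i) = lookup≡at w i

at-length : ∀ u {x v} → at (u ++ x ∷ v) (length u) ≡ x
at-length []      = refl
at-length (_ ∷ u) = at-length u

-- The position of the root of t when its word starts at position p.
end : ℕ → Tree → ℕ
end p (leaf x)     = p
end p (node l r x) = suc (end (suc (end p l)) r)

p≤end : ∀ p t → p ≤ end p t
p≤end p (leaf x)     = ≤-refl
p≤end p (node l r x) = m≤n⇒m≤1+n (≤-trans (p≤end p l) (≤-trans (n≤1+n _) (p≤end _ r)))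

length-++-word : ∀ u t → length (u ++ word t) ≡ suc (end (length u) t)
length-++-word u (leaf x) = trans (List.length-++ u) (+-comm (length u) 1)
length-++-word u (node l r x) = begin
  length (u ++ word l ++ word r ++ [ x ])       ≡⟨ cong length (List.++-assoc u (word l) _) ⟨
  length ((u ++ word l) ++ word r ++ [ x ])     ≡⟨ cong length (List.++-assoc (u ++ word l) (word r) _) ⟨
  length (((u ++ word l) ++ word r) ++ [ x ])   ≡⟨ trans (List.length-++ ((u ++ word l) ++ word r)) (+-comm _ 1) ⟩
  suc (length ((u ++ word l) ++ word r))        ≡⟨ cong suc (length-++-word (u ++ word l) r) ⟩
  suc (suc (end (length (u ++ word l)) r))      ≡⟨ cong (λ p → suc (suc (end p r))) (length-++-word u l) ⟩
  suc (suc (end (suc (end (length u) l)) r))    ∎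
  where open ≡-Reasoning

-- Locates a subtree inside a fixed word `π`, so that inductions over subtrees keep the positions of
-- the whole word.
data Occurs (π : Word) : Tree → ℕ → Set where
  leaf : ∀ {x p} → at π p ≡ x → Occurs π (leaf x) p
  node : ∀ {l r x p} → Occurs π l p → Occurs π r (suc (end p l)) → at π (end p (node l r x)) ≡ x →
         Occurs π (node l r x) p

occurs-word : ∀ u t v → Occurs (u ++ word t ++ v) t (length u)
occurs-word u (leaf x) v = leaf (at-length u)
occurs-word u (node l r x) v = node
  (subst (λ π → Occurs π l (length u)) (cong (u ++_) (sym assoc)) (occurs-word u l _))
  (subst₂ (λ π p → Occurs π r p) (trans (List.++-assoc u (word l) _) (cong (u ++_) (sym assoc))) (length-++-word u l)
    (occurs-word (u ++ word l) r (x ∷ v)))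
  (subst₂ (λ π p → at π p ≡ x)
    (trans (List.++-assoc (u ++ word l) (word r) _) (trans (List.++-assoc u (word l) _) (cong (u ++_) (sym assoc))))
    (trans (length-++-word (u ++ word l) r) (cong (λ p → suc (end p r)) (length-++-word u l)))
    (at-length ((u ++ word l) ++ word r)))
  where
  assoc : (word l ++ word r ++ [ x ]) ++ v ≡ word l ++ word r ++ x ∷ v
  assoc = trans (List.++-assoc (word l) _ v) (cong (word l ++_) (List.++-assoc (word r) [ x ] v))

at-first : ∀ {π t p} → Occurs π t p → at π p ≡ first t
at-first (leaf e)     = e
at-first (node o _ _) = at-first o

at-root : ∀ {π t p} → Occurs π t p → at π (end p t) ≡ root t
at-root (leaf e)     = e
at-root (node _ _ e) = e

locate : ∀ {p i} l r x → i ≤ end p (node l r x) →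
         i ≤ end p l ⊎ (suc (end p l) ≤ i × i ≤ end (suc (end p l)) r) ⊎ i ≡ end p (node l r x)
locate {p} {i} l r x i≤ with i ≤? end p l | m≤n⇒m<n∨m≡n i≤
... | yes i≤l | _               = inj₁ i≤l
... | no  i≰l | inj₁ (s≤s i≤r)  = inj₂ (inj₁ (≰⇒> i≰l , i≤r))
... | no  _   | inj₂ i≡         = inj₂ (inj₂ i≡)

at≤root : ∀ {π t p i} → Good t → Occurs π t p → p ≤ i → i ≤ end p t → at π i ≤ root t
at≤root leaf (leaf e) p≤i i≤p rewrite ≤-antisym p≤i i≤p = ≤-reflexive e
at≤root {t = node l r x} (node gl gr l<x r<x _) (node ol or e) p≤i i≤ with locate l r x i≤
... | inj₁ i≤l                 = <⇒≤ (≤-<-trans (at≤root gl ol p≤i i≤l) l<x)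
... | inj₂ (inj₁ (r≤i , i≤r))  = <⇒≤ (≤-<-trans (at≤root gr or r≤i i≤r) r<x)
... | inj₂ (inj₂ refl)         = ≤-reflexive e

at<root : ∀ {π l r x p i} → Good (node l r x) → Occurs π (node l r x) p → p ≤ i → i < end p (node l r x) → at π i < x
at<root {l = l} {r} {x} (node gl gr l<x r<x _) (node ol or e) p≤i i< with locate l r x (<⇒≤ i<)
... | inj₁ i≤l                 = ≤-<-trans (at≤root gl ol p≤i i≤l) l<x
... | inj₂ (inj₁ (r≤i , i≤r))  = ≤-<-trans (at≤root gr or r≤i i≤r) r<x
... | inj₂ (inj₂ refl)         = contradiction i< (<-irrefl refl)

-- A valid hook configuration reduced to the relation between the two ends of a hook: `nested` is
-- what remains of non-crossing, and `complete` says that every descent starts a hook.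
record HookSystem (π : Word) (_⟶_ : ℕ → ℕ → Set) : Set where
  field
    rightward : ∀ {i j} → i ⟶ j → i < j
    rising    : ∀ {i j} → i ⟶ j → at π i < at π j
    below     : ∀ {i j l} → i ⟶ j → i < l → l < j → at π l < at π j
    nested    : ∀ {i j i′ j′} → i ⟶ j → i′ ⟶ j′ → i < i′ → i′ < j → j′ < j
    bounded   : ∀ {i j} → i ⟶ j → j < length π
    complete  : ∀ {i} → suc i < length π → at π (suc i) < at π i → ∃[ j ] i ⟶ j

module _ {π _⟶_} (sys : HookSystem π _⟶_) where
  open HookSystem sys

  -- By induction a hook ending in `r` ends at its first entry, which is lower than the root of `l`
  -- just before it and so violates `below`. The root of a node is excluded by `node-not-entered`,
  -- and only the first leaf remains.
  enters-at-first : ∀ {t p i j} → Good t → Occurs π t p → end p t < length π →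
                    i ⟶ j → i < p → p ≤ j → j ≤ end p t → j ≡ p
  -- The hook leaving the root of l could not cross the entering one, so it would end
  -- inside r, hence at the first entry of r, which is too low.
  node-not-entered : ∀ {l r x p i} → Good (node l r x) → Occurs π (node l r x) p → end p (node l r x) < length π →
                     i < p → ¬ (i ⟶ end p (node l r x))

  enters-at-first leaf (leaf _) _ _ _ p≤j j≤p = ≤-antisym j≤p p≤j
  enters-at-first {node l r x} {p} g@(node gl gr l<x r<x r<l) o@(node ol or _) e< h i<p p≤j j≤ with locate l r x j≤
  ... | inj₁ j≤l = enters-at-first gl ol (<-trans (s≤s (≤-trans (n≤1+n _) (p≤end _ r))) e<) h i<p p≤j j≤l
  ... | inj₂ (inj₂ refl) = contradiction h (node-not-entered g o e< i<p)
  ... | inj₂ (inj₁ (r≤j , j≤r))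
      with refl ← enters-at-first gr or (<-trans (n<1+n _) e<) h (s≤s (≤-trans (<⇒≤ i<p) (p≤end p l))) r≤j j≤r =
    contradiction (below h (≤-trans i<p (p≤end p l)) (n<1+n _))
      (<-asym (subst₂ _<_ (sym (at-first or)) (sym (at-root ol)) r<l))

  node-not-entered {l} {r} {x} {p} (node gl gr l<x r<x r<l) (node ol or _) e< i<p h
    with desc ← subst₂ _<_ (sym (at-first or)) (sym (at-root ol)) r<l
    with j′ , h′ ← complete (<-trans (s≤s (p≤end _ r)) e<) desc
    with s≤s j′≤r ← nested h h′ (≤-trans i<p (p≤end p l)) (s≤s (≤-trans (n≤1+n _) (p≤end _ r)))
    with refl ← enters-at-first gr or (<-trans (n<1+n _) e<) h′ (n<1+n _) (rightward h′) j′≤r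
    = <-asym desc (rising h′)

  -- The descent after the root of `l` starts a hook. Inside `r` it could end only at the first
  -- entry, which is too low, so it ends at the last position. Of two hooks with different starts
  -- ending there, `nested` would place this position strictly before itself.
  top-hook-start : ∀ {l r x i} → Good (node l r x) → Occurs π (node l r x) 0 → length π ≡ suc (end 0 (node l r x)) →
                   i ⟶ end 0 (node l r x) ⇔ i ≡ end 0 l
  top-hook-start {l} {r} {x} (node gl gr l<x r<x r<l) (node ol or _) len
    with desc ← subst₂ _<_ (sym (at-first or)) (sym (at-root ol)) r<l
    with e< ← subst (end 0 (node l r x) <_) (sym len) (n<1+n _)
    with j , h ← complete (<-trans (s≤s (p≤end _ r)) e<) desc
    with m≤n⇒m<n∨m≡n (≤-pred (subst (j <_) len (bounded h)))
  ... | inj₁ (s≤s j≤r) with refl ← enters-at-first gr or (<-trans (n<1+n _) e<) h (n<1+n _) (rightward h) j≤r =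
    contradiction (rising h) (<-asym desc)
  ... | inj₂ refl = mk⇔ (λ h′ → unique h′ (<-cmp _ _)) λ { refl → h }
    where
    unique : ∀ {i} → i ⟶ j → Tri (i < end 0 l) (i ≡ end 0 l) (end 0 l < i) → i ≡ end 0 l
    unique h′ (tri< i<a _ _) = contradiction (nested h′ h i<a (rightward h)) (<-irrefl refl)
    unique h′ (tri≈ _ i≡a _) = i≡a
    unique h′ (tri> _ _ a<i) = contradiction (nested h h′ a<i (rightward h′)) (<-irrefl refl)

AllPairs-lookup : ∀ {X : Set} {R : X → X → Set} {xs x y} → AllPairs R xs → x ∈ xs → y ∈ xs → x ≡ y ⊎ R x y ⊎ R y x
AllPairs-lookup (r ∷ rs) (here refl) (here refl) = inj₁ refl
AllPairs-lookup (r ∷ rs) (here refl) (there y∈)  = inj₂ (inj₁ (All.lookup r y∈))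
AllPairs-lookup (r ∷ rs) (there x∈) (here refl)  = inj₂ (inj₂ (All.lookup r x∈))
AllPairs-lookup (r ∷ rs) (there x∈) (there y∈)   = AllPairs-lookup rs x∈ y∈

AllPairs-map-All : ∀ {X : Set} {P : X → Set} {R T : X → X → Set} {xs} →
                   (∀ {x y} → P x → P y → R x y → T x y) → All P xs → AllPairs R xs → AllPairs T xs
AllPairs-map-All f []       []       = []
AllPairs-map-All f (p ∷ ps) (r ∷ rs) = All.zipWith (uncurry (f p)) (ps , r) ∷ AllPairs-map-All f ps rs

module _ {π : Word} where
  open Ends {π}

  nonCrossing-sym : ∀ {H H′} → NonCrossing π H H′ → NonCrossing π H′ H
  nonCrossing-sym nc x y on′ on = Sum.swap (nc x y on on′)

  HookFrom : List (Ends π) → ℕ → ℕ → Set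
  HookFrom ℋ i j = ∃[ H ] H ∈ ℋ × toℕ (sw H) ≡ i × toℕ (ne H) ≡ j

  nonCrossing⇒nested : ∀ {H H′} → IsHook π H → IsHook π H′ → NoPointAbove π H → NoPointAbove π H′ →
                       NonCrossing π H H′ → sw H Fin.< sw H′ → sw H′ Fin.< ne H → ne H′ Fin.< ne H
  nonCrossing⇒nested {H} {H′} (h< , _) (h′< , _) np np′ nc i<i′ i′<j with <-cmp (toℕ (ne H′)) (toℕ (ne H))
  ... | tri< j′<j _ _ = j′<j
  -- Hooks with a common northeast endpoint meet there, and it is the southwest endpoint of neither.
  ... | tri≈ _ j′≡j _ with refl ← Fin.toℕ-injective j′≡j
    with nc (ne H) (top H) (inj₂ (<⇒≤ h< , ≤-refl , refl)) (inj₂ (<⇒≤ h′< , ≤-refl , refl))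
  ...   | inj₁ (_ , e , _) = contradiction (cong toℕ (sym e)) (<⇒≢ i′<j)
  ...   | inj₂ (_ , e , _) = contradiction (cong toℕ (sym e)) (<⇒≢ h<)
  nonCrossing⇒nested {H} {H′} (h< , _) (h′< , _) np np′ nc i<i′ i′<j | tri> _ _ j<j′
    -- The crossing point: the vertical part of `H′` starts under `H` and rises to a height above
    -- `ne H`, so it meets the horizontal part of `H`.
    with nc (sw H′) (top H) (inj₂ (<⇒≤ i<i′ , <⇒≤ i′<j , refl))
            (inj₁ (refl , <⇒≤ (np (sw H′) i<i′ i′<j) , <⇒≤ (np′ (ne H) i′<j j<j′)))
  ... | inj₁ ((e , _) , _) = contradiction (cong toℕ e) (<⇒≢ i′<j)
  ... | inj₂ ((e , _) , _) = contradiction (cong toℕ e) (<⇒≢ h′<)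

  valid⇒hookSystem : ∀ {ℋ} → Valid π ℋ → HookSystem π (HookFrom ℋ)
  valid⇒hookSystem {ℋ} (valid hooks atDesc above nc) = record
    { rightward = λ { (H , H∈ , refl , refl) → proj₁ (All.lookup hooks H∈) }
    ; rising    = λ { (H , H∈ , refl , refl) →
                    subst₂ _<_ (lookup≡at π (sw H)) (lookup≡at π (ne H)) (proj₂ (All.lookup hooks H∈)) }
    ; below     = λ { {l = l} (H , H∈ , refl , refl) i<l l<j → below H H∈ i<l l<j }
    ; nested    = λ { (H , H∈ , refl , refl) (H′ , H′∈ , refl , refl) i<i′ i′<j → nested H∈ H′∈ i<i′ i′<j }
    ; bounded   = λ { (H , _ , _ , refl) → Fin.toℕ<n (ne H) }
    ; complete  = complete
    }
    where
    below : ∀ {l} H → H ∈ ℋ → toℕ (sw H) < l → l < toℕ (ne H) → at π l < at π (toℕ (ne H))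
    below {l} H H∈ i<l l<j = subst₂ _<_ (trans (lookup≡at π p) (cong (at π) p≡l)) (lookup≡at π (ne H))
      (All.lookup above H∈ p (subst (_ <_) (sym p≡l) i<l) (subst (_< _) (sym p≡l) l<j))
      where
      l<n : l < length π
      l<n = <-trans l<j (Fin.toℕ<n (ne H))
      p = fromℕ< l<n
      p≡l : toℕ p ≡ l
      p≡l = Fin.toℕ-fromℕ< l<n
    nested : ∀ {H H′} → H ∈ ℋ → H′ ∈ ℋ → sw H Fin.< sw H′ → sw H′ Fin.< ne H → ne H′ Fin.< ne H
    nested {H} {H′} H∈ H′∈ i<i′ i′<j with AllPairs-lookup nc H∈ H′∈
    ... | inj₁ refl      = contradiction i<i′ (<-irrefl refl)
    ... | inj₂ crossFree = nonCrossing⇒nested (All.lookup hooks H∈) (All.lookup hooks H′∈)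
                             (All.lookup above H∈) (All.lookup above H′∈)
                             ([ (λ c → c) , nonCrossing-sym {H′} {H} ]′ crossFree) i<i′ i′<j
    complete : ∀ {i} → suc i < length π → at π (suc i) < at π i → ∃[ j ] HookFrom ℋ i j
    complete {i} si<n desc
      with i<n ← <-trans (n<1+n i) si<n
      with H , H∈ , eq ← ∈-map⁻ sw (subst (fromℕ< i<n ∈_) (sym atDesc) (∈-filter⁺ (descent? π) (∈-allFin _)
             (fromℕ< si<n , trans (Fin.toℕ-fromℕ< si<n) (cong suc (sym (Fin.toℕ-fromℕ< i<n))) ,
              subst₂ _<_ (sym (trans (lookup≡at π _) (cong (at π) (Fin.toℕ-fromℕ< si<n))))
                         (sym (trans (lookup≡at π _) (cong (at π) (Fin.toℕ-fromℕ< i<n)))) desc)))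
      = toℕ (ne H) , H , H∈ , trans (cong toℕ (sym eq)) (Fin.toℕ-fromℕ< i<n) , refl

  -- The vertical part of `H` lies to the left of `H′`. A common point on the horizontal part is the
  -- joint if `H` ends first; otherwise it would be too high, since the northeast endpoint of `H′`
  -- lies below the top of `H`.
  nested⇒nonCrossing : ∀ {H H′} → IsHook π H′ → NoPointAbove π H → sw H Fin.< sw H′ →
                       ne H Fin.≤ sw H′ ⊎ ne H′ Fin.< ne H → NonCrossing π H H′
  nested⇒nonCrossing {H} {H′} (h′< , _) np i<i′ apart x y on on′ = go on apart
    where
    i′≤x : sw H′ Fin.≤ x
    i′≤x = [ (λ (e , _) → ≤-reflexive (cong toℕ (sym e))) , proj₁ ]′ on′
    go : OnHook π H x y → ne H Fin.≤ sw H′ ⊎ ne H′ Fin.< ne H → Joint π H H′ x y ⊎ Joint π H′ H x y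
    go (inj₁ (refl , _)) _ = contradiction i<i′ (≤⇒≯ i′≤x)
    go (inj₂ (_ , x≤j , refl)) (inj₁ j≤i′)
      with refl ← Fin.toℕ-injective (≤-antisym x≤j (≤-trans j≤i′ i′≤x))
      with e ← Fin.toℕ-injective (≤-antisym i′≤x j≤i′)
      = inj₁ ((refl , refl) , sym e , cong (lookup π) (sym e))
    go (inj₂ (_ , _ , refl)) (inj₂ j′<j) =
      contradiction (onHook⇒≤top π H′ on′) (<⇒≱ (np (ne H′) (<-trans i<i′ h′<) j′<j))

-- The hook configuration of a good tree

data Hook : Tree → ℕ → ℕ → ℕ → Set where
  inˡ : ∀ {l r x p i j} → Hook l p i j → Hook (node l r x) p i j
  inʳ : ∀ {l r x p i j} → Hook r (suc (end p l)) i j → Hook (node l r x) p i j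
  top : ∀ {l r x p} → Hook (node l r x) p (end p l) (end p (node l r x))

hook-bounds : ∀ {t p i j} → Hook t p i j → p ≤ i × i < j × j ≤ end p t
hook-bounds {node l r x} {p} (inˡ h) with p≤i , i<j , j≤ ← hook-bounds h =
  p≤i , i<j , ≤-trans j≤ (m≤n⇒m≤1+n (≤-trans (n≤1+n _) (p≤end _ r)))
hook-bounds {node l r x} {p} (inʳ h) with p≤i , i<j , j≤ ← hook-bounds h =
  ≤-trans (m≤n⇒m≤1+n (p≤end p l)) p≤i , i<j , m≤n⇒m≤1+n j≤
hook-bounds {node l r x} {p} top = p≤end p l , s≤s (≤-trans (n≤1+n _) (p≤end _ r)) , ≤-refl

hook-above : ∀ {π t p i j l} → Good t → Occurs π t p → Hook t p i j → i ≤ l → l < j → at π l < at π j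
hook-above (node gl gr _ _ _) (node ol _ _) (inˡ h) i≤l l<j = hook-above gl ol h i≤l l<j
hook-above (node gl gr _ _ _) (node _ or _) (inʳ h) i≤l l<j = hook-above gr or h i≤l l<j
hook-above {t = node l _ _} {p} g o@(node _ _ refl) top i≤l l<j = at<root g o (≤-trans (p≤end p l) i≤l) l<j

hook-nested : ∀ {t p i j i′ j′} → Hook t p i j → Hook t p i′ j′ → i < i′ → j ≤ i′ ⊎ j′ < j
hook-nested (inˡ h) (inˡ h′) i<i′ = hook-nested h h′ i<i′
hook-nested (inˡ h) (inʳ h′) i<i′ = inj₁
  (≤-trans (proj₂ (proj₂ (hook-bounds h))) (≤-trans (n≤1+n _) (proj₁ (hook-bounds h′))))
hook-nested (inˡ h) top      i<i′ = inj₁ (proj₂ (proj₂ (hook-bounds h)))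
hook-nested (inʳ h) (inˡ h′) i<i′ with _ , i′<j′ , j′≤ ← hook-bounds h′ =
  contradiction i<i′ (<⇒≯ (<-≤-trans (<-≤-trans i′<j′ j′≤) (≤-trans (n≤1+n _) (proj₁ (hook-bounds h)))))
hook-nested (inʳ h) (inʳ h′) i<i′ = hook-nested h h′ i<i′
hook-nested (inʳ h) top      i<i′ = contradiction i<i′ (<⇒≯ (proj₁ (hook-bounds h)))
hook-nested top     (inˡ h′) i<i′ with _ , i′<j′ , j′≤ ← hook-bounds h′ =
  contradiction (<-trans i<i′ i′<j′) (≤⇒≯ j′≤)
hook-nested top     (inʳ h′) i<i′ = inj₂ (s≤s (proj₂ (proj₂ (hook-bounds h′))))
hook-nested top     top      i<i′ = contradiction i<i′ (<-irrefl refl)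

-- The cases locate the lower entry `suc i` of the descent: within `l`, within `r`, at the first
-- entry of `r`, where `top` applies, or at the root, which exceeds everything before it.
hook-complete : ∀ {π t p i} → Good t → Occurs π t p → p ≤ i → i < end p t → at π (suc i) < at π i → ∃[ j ] Hook t p i j
hook-complete leaf (leaf _) p≤i i<p _ = contradiction i<p (≤⇒≯ p≤i)
hook-complete {π} {node l r x} {p} {i} g@(node gl gr _ _ _) o@(node ol or e) p≤i i<e desc with locate l r x i<e
... | inj₁ i<l with j , h ← hook-complete gl ol p≤i i<l desc = j , inˡ h
... | inj₂ (inj₁ (s≤s l≤i , i<r)) with m≤n⇒m<n∨m≡n l≤i
...   | inj₂ refl = _ , top
...   | inj₁ r≤i with j , h ← hook-complete gr or r≤i i<r desc = j , inʳ h
hook-complete {π} g o@(node ol or e) p≤i i<e desc | inj₂ (inj₂ refl) =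
  contradiction (at<root g o p≤i i<e) (<-asym (subst (_< at π _) e desc))

module _ {t} (g : Good t) where

  private
    π : Word
    π = word t

  open Ends {π} using (sw; ne)

  private
    occurs : Occurs π t 0
    occurs = subst (λ w → Occurs w t 0) (List.++-identityʳ π) (occurs-word [] t [])

    length≡ : length π ≡ suc (end 0 t)
    length≡ = length-++-word [] t

    Canonical : Ends π → Set
    Canonical H = Hook t 0 (toℕ (sw H)) (toℕ (ne H))

    position : ∀ {j} → j ≤ end 0 t → ∃[ p ] toℕ {length π} p ≡ j
    position j≤ = _ , Fin.toℕ-fromℕ< (subst (_ <_) (sym length≡) (s≤s j≤))

    canonical-hooks : ∀ {ds} → All (Descent π) ds → ∃[ ℋ ] map sw ℋ ≡ ds × All Canonical ℋ
    canonical-hooks [] = [] , refl , []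
    canonical-hooks {d ∷ _} ((d′ , d′≡ , desc) ∷ ps)
      with ℋ , refl , cs ← canonical-hooks ps
      with j , h ← hook-complete g occurs z≤n
                     (≤-pred (subst₂ _<_ d′≡ length≡ (Fin.toℕ<n d′)))
                     (subst₂ _<_ (trans (lookup≡at π d′) (cong (at π) d′≡)) (lookup≡at π d) desc)
      with e , refl ← position (proj₂ (proj₂ (hook-bounds h)))
      = ends d e ∷ ℋ , refl , h ∷ cs

    canonical-above : ∀ {H} → Canonical H → ∀ l → sw H Fin.≤ l → l Fin.< ne H → lookup π l < lookup π (ne H)
    canonical-above {H} h l i≤l l<j =
      subst₂ _<_ (sym (lookup≡at π l)) (sym (lookup≡at π (ne H))) (hook-above g occurs h i≤l l<j)

    canonical-isHook : ∀ {H} → Canonical H → IsHook π H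
    canonical-isHook {H} h = i<j , canonical-above {H} h (sw H) ≤-refl i<j
      where
      i<j : sw H Fin.< ne H
      i<j = proj₁ (proj₂ (hook-bounds h))

    canonical-noPointAbove : ∀ {H} → Canonical H → NoPointAbove π H
    canonical-noPointAbove {H} h l i<l l<j = canonical-above {H} h l (<⇒≤ i<l) l<j

    canonical-nonCrossing : ∀ {H H′} → Canonical H → Canonical H′ → sw H ≢ sw H′ → NonCrossing π H H′
    canonical-nonCrossing {H} {H′} h h′ i≢i′ with <-cmp (toℕ (sw H)) (toℕ (sw H′))
    ... | tri≈ _ e _ = contradiction (Fin.toℕ-injective e) i≢i′
    ... | tri< i<i′ _ _ =
      nested⇒nonCrossing {π} {H} {H′} (canonical-isHook {H′} h′) (canonical-noPointAbove {H} h) i<i′ (hook-nested h h′ i<i′)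
    ... | tri> _ _ i′<i = nonCrossing-sym {π} {H′} {H}
      (nested⇒nonCrossing {π} {H′} {H} (canonical-isHook {H} h) (canonical-noPointAbove {H′} h′)
        i′<i (hook-nested h′ h i′<i))

  good⇒valid : ∃[ ℋ ] Valid π ℋ
  good⇒valid with ℋ , e , cs ← canonical-hooks (All.all-filter (descent? π) (allFin (length π))) =
    ℋ , valid (All.map canonical-isHook cs) e (All.map canonical-noPointAbove cs)
      (AllPairs-map-All (λ {H} {H′} → canonical-nonCrossing {H} {H′}) cs
        (AP.map⁻ (subst Unique (sym e) (Unique.filter⁺ (descent? π) (Unique.allFin⁺ _)))))

module _ {l r x} (g : Good (node l r x)) where

  private
    π : Word
    π = word (node l r x)

  open Ends {π} using (sw; ne) renaming (top to height)

  private
    occurs : Occurs π (node l r x) 0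
    occurs = subst (λ w → Occurs w (node l r x) 0) (List.++-identityʳ π) (occurs-word [] (node l r x) [])

    length≡ : length π ≡ suc (end 0 (node l r x))
    length≡ = length-++-word [] (node l r x)

    first-right : Position π
    first-right = fromℕ< (subst (suc (end 0 l) <_) (sym length≡) (s≤s (m≤n⇒m≤1+n (p≤end _ r))))

    first-right≡ : toℕ first-right ≡ suc (end 0 l)
    first-right≡ = Fin.toℕ-fromℕ< _

    lookup-first-right : lookup π first-right ≡ first r
    lookup-first-right with node _ or _ ← occurs =
      trans (lookup≡at π first-right) (trans (cong (at π) first-right≡) (at-first or))

    TopEnds : Ends π → Set
    TopEnds H = toℕ (sw H) ≡ end 0 l × toℕ (ne H) ≡ end 0 (node l r x)

    leftmost : ∀ {H} → TopEnds H → LeftmostSheltered π H first-right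
    leftmost {H} (i≡ , j≡) =
      (subst₂ _<_ (sym i≡) (sym first-right≡) (n<1+n _) ,
       subst₂ _<_ (sym first-right≡) (sym j≡) (s≤s (p≤end _ r))) ,
      λ k (i<k , _) → subst (_≤ toℕ k) (sym first-right≡) (subst (_< toℕ k) i≡ i<k)

    leftmost-unique : ∀ {H j} → TopEnds H → LeftmostSheltered π H j → j ≡ first-right
    leftmost-unique {H} {j} te (sheltered , least) with sheltered′ , least′ ← leftmost {H} te =
      Fin.toℕ-injective (≤-antisym (least first-right sheltered′) (least′ j sheltered))

    height≤x : ∀ p → lookup π p ≤ x
    height≤x p = subst (_≤ x) (sym (lookup≡at π p))
      (at≤root g occurs z≤n (≤-pred (subst (toℕ p <_) length≡ (Fin.toℕ<n p))))

    highest-is-last : ∀ p → x ≤ lookup π p → toℕ p ≡ end 0 (node l r x)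
    highest-is-last p x≤ with m≤n⇒m<n∨m≡n (≤-pred (subst (toℕ p <_) length≡ (Fin.toℕ<n p)))
    ... | inj₂ e = e
    ... | inj₁ p< = contradiction (subst (x ≤_) (lookup≡at π p) x≤) (<⇒≱ (at<root g occurs z≤n p<))

    topEnds-height : ∀ {H} → TopEnds H → height H ≡ x
    topEnds-height {H} (_ , j≡) = trans (lookup≡at π (ne H)) (trans (cong (at π) j≡) (at-root occurs))

    module _ {ℋ} (v : Valid π ℋ) where

      start⇔ : ∀ {i} → HookFrom ℋ i (end 0 (node l r x)) ⇔ i ≡ end 0 l
      start⇔ = top-hook-start (valid⇒hookSystem v) g occurs length≡

      topEnds∈ : ∃[ H ] H ∈ ℋ × TopEnds H
      topEnds∈ = Equivalence.from start⇔ refl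

      -- Some hook reaches the height `x`, so the top hook does as well; `x` is attained only at the
      -- last position, and `start⇔` fixes where a hook ending there begins.
      topHook⇒topEnds : ∀ {H} → H ∈ ℋ → TopHook π ℋ H → TopEnds H
      topHook⇒topEnds {H} H∈ highest with H′ , H′∈ , te ← topEnds∈
        with j≡ ← highest-is-last (ne H) (subst (_≤ height H) (topEnds-height {H′} te) (All.lookup highest H′∈))
        = Equivalence.to start⇔ (H , H∈ , refl , j≡) , j≡

  -- In every valid configuration the top hook runs from the root of `l` to the last position, so it
  -- shelters exactly the word of `r`. The backward direction takes its configuration from
  -- `good⇒valid`.
  hasEye⇔ : ∀ {e} → HasEye π e ⇔ first r ≡ e
  hasEye⇔ = mk⇔ to from
    where
    to : ∀ {e} → HasEye π e → first r ≡ e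
    to (ℋ , v , any) with H , H∈ , highest , j , lm , refl ← find any =
      trans (sym lookup-first-right)
        (cong (lookup π) (sym (leftmost-unique {H} (topHook⇒topEnds v {H} H∈ highest) lm)))
    from : ∀ {e} → first r ≡ e → HasEye π e
    from refl with ℋ , v ← good⇒valid g with H , H∈ , te ← topEnds∈ v =
      ℋ , v , lose H∈
        (All.tabulate (λ {H′} _ → subst (height H′ ≤_) (sym (topEnds-height {H} te)) (height≤x (ne H′))) ,
         first-right , leftmost {H} te , lookup-first-right)

-- Counting

-- The image of the filtered `ys` and the filtered `xs` are duplicate-free lists with the same
-- members, hence permutations of each other.
filter-bijection : ∀ {X Y : Set} {P : X → Set} {Q : Y → Set} (P? : Decidable P) (Q? : Decidable Q) {xs ys} →
  Unique xs → Unique ys → (f : Y → X) →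
  (∀ {y} → y ∈ ys → Q y → f y ∈ xs × P (f y)) →
  (∀ {y y′} → y ∈ ys → Q y → y′ ∈ ys → Q y′ → f y ≡ f y′ → y ≡ y′) →
  (∀ {x} → x ∈ xs → P x → ∃[ y ] y ∈ ys × Q y × f y ≡ x) →
  length (filter P? xs) ≡ length (filter Q? ys)
filter-bijection P? Q? {xs} {ys} uxs uys f to injective onto = begin
  length (filter P? xs)
    ≡⟨ ↭-length (∼bag⇒↭ (unique∧set⇒bag (Unique.filter⁺ P? uxs) unique-image (mk⇔ there′ back))) ⟩
  length (map f (filter Q? ys))
    ≡⟨ List.length-map f (filter Q? ys) ⟩
  length (filter Q? ys) ∎
  where
  open ≡-Reasoning
  unique-image : Unique (map f (filter Q? ys))
  unique-image = AP.map⁺ (AllPairs-map-All (λ (y∈ , qy) (y′∈ , qy′) y≢ e → y≢ (injective y∈ qy y′∈ qy′ e))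
    (All.tabulate (∈-filter⁻ Q? {xs = ys})) (Unique.filter⁺ Q? uys))
  there′ : ∀ {x} → x ∈ filter P? xs → x ∈ map f (filter Q? ys)
  there′ x∈ with x∈xs , px ← ∈-filter⁻ P? {xs = xs} x∈ with y , y∈ , qy , refl ← onto x∈xs px =
    ∈-map⁺ f (∈-filter⁺ Q? y∈ qy)
  back : ∀ {x} → x ∈ map f (filter Q? ys) → x ∈ filter P? xs
  back x∈ with y , y∈ , refl ← ∈-map⁻ f x∈ with y∈ys , qy ← ∈-filter⁻ Q? {xs = ys} y∈ =
    uncurry (∈-filter⁺ P?) (to y∈ys qy)

filter-split : ∀ {X : Set} {P Q : X → Set} (P? : Decidable P) (Q? : Decidable Q) xs →
  length (filter P? xs) ≡ length (filter (λ x → P? x ×-dec Q? x) xs) + length (filter (λ x → P? x ×-dec ¬? (Q? x)) xs)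
filter-split P? Q? [] = refl
filter-split P? Q? (x ∷ xs) with does (P? x) | does (Q? x)
... | false | _     = filter-split P? Q? xs
... | true  | true  = cong suc (filter-split P? Q? xs)
... | true  | false = trans (cong suc (filter-split P? Q? xs)) (sym (+-suc _ _))

filter-cong : ∀ {X : Set} {P Q : X → Set} (P? : Decidable P) (Q? : Decidable Q) {xs} →
  (∀ {x} → x ∈ xs → P x ⇔ Q x) → length (filter P? xs) ≡ length (filter Q? xs)
filter-cong P? Q? {[]} f = refl
filter-cong P? Q? {x ∷ xs} f with P? x | Q? x
... | yes _ | yes _ = cong suc (filter-cong P? Q? (f ∘ there))
... | no  _ | no  _ = filter-cong P? Q? (f ∘ there)
... | yes p | no ¬q = contradiction (Equivalence.to (f (here refl)) p) ¬q
... | no ¬p | yes q = contradiction (Equivalence.from (f (here refl)) q) ¬p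

-- A finite stock of candidates, good or not, from which `pairs` selects: trees with at most `h`
-- levels and labels from `L`.
trees : ℕ → Word → List Tree
trees zero    L = []
trees (suc h) L = map leaf L ++
  cartesianProductWith (λ (l , r) x → node l r x) (cartesianProduct (trees h L) (trees h L)) L

trees-unique : ∀ h {L} → Unique L → Unique (trees h L)
trees-unique zero    u = []
trees-unique (suc h) {L} u = Unique.++⁺ (Unique.map⁺ (λ { refl → refl }) u)
  (Unique.cartesianProductWith⁺ _ (λ { refl → refl , refl })
    (Unique.cartesianProduct⁺ (trees-unique h u) (trees-unique h u)) u)
  λ (p , q) → disjoint (∈-map⁻ leaf p) (∈-cartesianProductWith⁻ _ (cartesianProduct (trees h L) (trees h L)) L q)
  where
  disjoint : ∀ {t} → ∃[ x ] x ∈ L × t ≡ leaf x →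
             ¬ (∃[ lr ] ∃[ x ] lr ∈ cartesianProduct (trees h L) (trees h L) × x ∈ L × t ≡ node (proj₁ lr) (proj₂ lr) x)
  disjoint (_ , _ , refl) (_ , _ , _ , _ , ())

-- The word of a child is shorter than that of its parent, so the length of the word bounds the
-- number of levels.
trees-complete : ∀ h {L} t → length (word t) ≤ h → All (_∈ L) (word t) → t ∈ trees h L
trees-complete zero t p _ = contradiction (subst (λ w → length w ≤ 0) (proj₂ (word-first t)) p) λ ()
trees-complete (suc h) (leaf x) p (x∈ ∷ _) = ∈-++⁺ˡ (∈-map⁺ leaf x∈)
trees-complete (suc h) {L} (node l r x) p ∈L
  with s≤s p′ ← subst (_≤ suc h) (length-join (word l) (word r) x) p = ∈-++⁺ʳ (map leaf L)
  (∈-cartesianProductWith⁺ _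
    (∈-cartesianProduct⁺
      (trees-complete h l (≤-trans (m≤m+n _ _) p′) (All.++⁻ˡ (word l) ∈L))
      (trees-complete h r (≤-trans (m≤n+m _ _) p′) (All.++⁻ˡ (word r) (All.++⁻ʳ (word l) ∈L))))
    (All.head (All.++⁻ʳ (word r) (All.++⁻ʳ (word l) ∈L))))

good? : Decidable Good
good? (leaf x) = yes leaf
good? (node l r x) = map′ (λ (a , b , c , d , e) → node a b c d e) (λ { (node a b c d e) → a , b , c , d , e })
  (good? l ×-dec good? r ×-dec (root l <? x) ×-dec (root r <? x) ×-dec (first r <? root l))

labels : ℕ → Word
labels m = map suc (downFrom m)

labels-unique : ∀ m → Unique (labels m)
labels-unique m = Unique.map⁺ suc-injective (Unique.downFrom⁺ m)

label-bounds : ∀ m {y} → y ∈ labels m → 1 ≤ y × y ≤ m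
label-bounds (suc m) (here refl) = s≤s z≤n , ≤-refl
label-bounds (suc m) (there y∈)  = map₂ m≤n⇒m≤1+n (label-bounds m y∈)

-- The last condition says that the labels of the two trees partition {1,...,m}.
IsPair : ℕ → Tree × Tree → Set
IsPair m (a , b) = Good a × Good b × word a ++ word b ∈ S m

isPair? : ∀ m → Decidable (IsPair m)
isPair? m (a , b) = good? a ×-dec good? b ×-dec (word a ++ word b ∈? S m)
  where open import Data.List.Membership.DecPropositional (List.≡-dec _≟_) using (_∈?_)

pairs : ℕ → List (Tree × Tree)
pairs m = filter (isPair? m) (cartesianProduct (trees m (labels m)) (trees m (labels m)))

pairs-unique : ∀ m → Unique (pairs m)
pairs-unique m = Unique.filter⁺ (isPair? m)
  (Unique.cartesianProduct⁺ (trees-unique m (labels-unique m)) (trees-unique m (labels-unique m)))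

pairs⇒isPair : ∀ {m p} → p ∈ pairs m → IsPair m p
pairs⇒isPair {m} p∈ = proj₂
  (∈-filter⁻ (isPair? m) {xs = cartesianProduct (trees m (labels m)) (trees m (labels m))} p∈)

isPair⇒pairs : ∀ {m p} → IsPair m p → p ∈ pairs m
isPair⇒pairs {m} {a , b} ip@(_ , _ , ab∈) =
  ∈-filter⁺ (isPair? m) (∈-cartesianProduct⁺
    (trees-complete m a (≤-trans (m≤m+n _ _) lengths) (All.++⁻ˡ (word a) members))
    (trees-complete m b (≤-trans (m≤n+m _ _) lengths) (All.++⁻ʳ (word a) members))) ip
  where
  perm : word a ++ word b ↭ labels m
  perm = ∈S⇒↭ m ab∈
  lengths : length (word a) + length (word b) ≤ m
  lengths = ≤-reflexive (trans (sym (List.length-++ (word a)))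
    (trans (↭-length perm) (trans (List.length-map suc (downFrom m)) (List.length-downFrom m))))
  members : All (_∈ labels m) (word a ++ word b)
  members = All.tabulate (∈-resp-↭ perm)

-- Relabelling

mapTree : (ℕ → ℕ) → Tree → Tree
mapTree f (leaf x)     = leaf (f x)
mapTree f (node l r x) = node (mapTree f l) (mapTree f r) (f x)

word-mapTree : ∀ f t → word (mapTree f t) ≡ map f (word t)
word-mapTree f (leaf x)     = refl
word-mapTree f (node l r x) = begin
  word (mapTree f l) ++ word (mapTree f r) ++ [ f x ]
    ≡⟨ cong₂ (λ u v → u ++ v ++ [ f x ]) (word-mapTree f l) (word-mapTree f r) ⟩
  map f (word l) ++ map f (word r) ++ [ f x ]
    ≡⟨ cong (map f (word l) ++_) (List.map-++ f (word r) [ x ]) ⟨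
  map f (word l) ++ map f (word r ++ [ x ])
    ≡⟨ List.map-++ f (word l) _ ⟨
  map f (word l ++ word r ++ [ x ]) ∎
  where open ≡-Reasoning

root-mapTree : ∀ f t → root (mapTree f t) ≡ f (root t)
root-mapTree f (leaf x)     = refl
root-mapTree f (node l r x) = refl

first-mapTree : ∀ f t → first (mapTree f t) ≡ f (first t)
first-mapTree f (leaf x)     = refl
first-mapTree f (node l r x) = first-mapTree f l

mapTree-id : ∀ {f} t → All (λ y → f y ≡ y) (word t) → mapTree f t ≡ t
mapTree-id (leaf x) (e ∷ []) = cong leaf e
mapTree-id {f} (node l r x) es
  rewrite mapTree-id {f} l (All.++⁻ˡ (word l) es)
        | mapTree-id {f} r (All.++⁻ˡ (word r) (All.++⁻ʳ (word l) es))
        | All.head (All.++⁻ʳ (word r) (All.++⁻ʳ (word l) es)) = refl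

mapTree-∘ : ∀ f g t → mapTree f (mapTree g t) ≡ mapTree (f ∘ g) t
mapTree-∘ f g (leaf x)     = refl
mapTree-∘ f g (node l r x) = cong₂ (λ l r → node l r (f (g x))) (mapTree-∘ f g l) (mapTree-∘ f g r)

mapTree-good : ∀ {f t} → (∀ {x y} → x < y → f x < f y) → Good t → Good (mapTree f t)
mapTree-good mono leaf = leaf
mapTree-good {f} {node l r x} mono (node gl gr l<x r<x r<l) = node (mapTree-good mono gl) (mapTree-good mono gr)
  (subst (_< f x) (sym (root-mapTree f l)) (mono l<x)) (subst (_< f x) (sym (root-mapTree f r)) (mono r<x))
  (subst₂ _<_ (sym (first-mapTree f r)) (sym (root-mapTree f l)) (mono r<l))

mapTree-good⁻ : ∀ {f} t → (∀ {x y} → f x < f y → x < y) → Good (mapTree f t) → Good t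
mapTree-good⁻ (leaf x) reflect leaf = leaf
mapTree-good⁻ {f} (node l r x) reflect (node gl gr l<x r<x r<l) =
  node (mapTree-good⁻ l reflect gl) (mapTree-good⁻ r reflect gr)
  (reflect (subst (_< f x) (root-mapTree f l) l<x)) (reflect (subst (_< f x) (root-mapTree f r) r<x))
  (reflect (subst₂ _<_ (first-mapTree f r) (root-mapTree f l) r<l))

-- `raise ℓ` skips the value `ℓ`, making room for a new label; `lower ℓ` closes the gap again.
raise lower : ℕ → ℕ → ℕ
raise ℓ y = if does (y <? ℓ) then y else suc y
lower ℓ y = if does (y <? ℓ) then y else pred y

raise-below : ∀ {ℓ y} → y < ℓ → raise ℓ y ≡ y
raise-below {ℓ} {y} y<ℓ rewrite dec-true (y <? ℓ) y<ℓ = refl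

raise-above : ∀ {ℓ y} → ℓ ≤ y → raise ℓ y ≡ suc y
raise-above {ℓ} {y} ℓ≤y rewrite dec-false (y <? ℓ) (≤⇒≯ ℓ≤y) = refl

lower-below : ∀ {ℓ y} → y < ℓ → lower ℓ y ≡ y
lower-below {ℓ} {y} y<ℓ rewrite dec-true (y <? ℓ) y<ℓ = refl

lower-above : ∀ {ℓ y} → ℓ ≤ y → lower ℓ y ≡ pred y
lower-above {ℓ} {y} ℓ≤y rewrite dec-false (y <? ℓ) (≤⇒≯ ℓ≤y) = refl

lower-raise : ∀ ℓ y → lower ℓ (raise ℓ y) ≡ y
lower-raise ℓ y with y <? ℓ
... | yes y<ℓ = trans (cong (lower ℓ) (raise-below y<ℓ)) (lower-below y<ℓ)
... | no  y≮ℓ = trans (cong (lower ℓ) (raise-above (≮⇒≥ y≮ℓ))) (lower-above (m≤n⇒m≤1+n (≮⇒≥ y≮ℓ)))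

raise-lower : ∀ {ℓ y} → ℓ ≢ y → raise ℓ (lower ℓ y) ≡ y
raise-lower {ℓ} {y} ℓ≢y with <-cmp ℓ y
... | tri< ℓ<y@(s≤s ℓ≤) _ _ = trans (cong (raise ℓ) (lower-above (<⇒≤ ℓ<y))) (raise-above ℓ≤)
... | tri≈ _ ℓ≡y _ = contradiction ℓ≡y ℓ≢y
... | tri> _ _ y<ℓ = trans (cong (raise ℓ) (lower-below y<ℓ)) (raise-below y<ℓ)

raise-mono-< : ∀ ℓ {x y} → x < y → raise ℓ x < raise ℓ y
raise-mono-< ℓ {x} {y} x<y with x <? ℓ | y <? ℓ
... | yes x<ℓ | yes y<ℓ = subst₂ _<_ (sym (raise-below x<ℓ)) (sym (raise-below y<ℓ)) x<y
... | yes x<ℓ | no  y≮ℓ = subst₂ _<_ (sym (raise-below x<ℓ)) (sym (raise-above (≮⇒≥ y≮ℓ))) (m≤n⇒m≤1+n x<y)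
... | no  x≮ℓ | yes y<ℓ = contradiction (<-trans x<y y<ℓ) x≮ℓ
... | no  x≮ℓ | no  y≮ℓ = subst₂ _<_ (sym (raise-above (≮⇒≥ x≮ℓ))) (sym (raise-above (≮⇒≥ y≮ℓ))) (s≤s x<y)

raise-cancel-< : ∀ ℓ {x y} → raise ℓ x < raise ℓ y → x < y
raise-cancel-< ℓ {x} {y} p with <-cmp x y
... | tri< x<y _ _  = x<y
... | tri≈ _ refl _ = contradiction p (<-irrefl refl)
... | tri> _ _ y<x  = contradiction (raise-mono-< ℓ y<x) (<-asym p)

raise<ℓ : ∀ {ℓ y} → raise ℓ y < ℓ ⇔ y < ℓ
raise<ℓ {ℓ} {y} = mk⇔ to λ y<ℓ → subst (_< ℓ) (sym (raise-below y<ℓ)) y<ℓ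
  where
  to : raise ℓ y < ℓ → y < ℓ
  to p with y <? ℓ
  ... | yes y<ℓ = y<ℓ
  ... | no  y≮ℓ = contradiction (<-trans (n<1+n y) (subst (_< ℓ) (raise-above (≮⇒≥ y≮ℓ)) p)) y≮ℓ

ℓ<raise : ∀ {ℓ y} → ℓ < raise ℓ y ⇔ ℓ ≤ y
ℓ<raise {ℓ} {y} = mk⇔ to λ ℓ≤y → subst (ℓ <_) (sym (raise-above ℓ≤y)) (s≤s ℓ≤y)
  where
  to : ℓ < raise ℓ y → ℓ ≤ y
  to p with y <? ℓ
  ... | yes y<ℓ = contradiction (<-trans (subst (ℓ <_) (raise-below y<ℓ) p) y<ℓ) (<-irrefl refl)
  ... | no  y≮ℓ = ≮⇒≥ y≮ℓ

lower-raise-word : ∀ ℓ w → map (lower ℓ) (map (raise ℓ) w) ≡ w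
lower-raise-word ℓ w = trans (sym (List.map-∘ w)) (List.map-id-local (All.tabulate λ {y} _ → lower-raise ℓ y))

-- If `ℓ` is the new maximum, raising changes nothing. Otherwise the old maximum is raised to the
-- new one, and the induction hypothesis handles the rest.
raise-labels : ∀ {ℓ} m → 1 ≤ ℓ → ℓ ≤ suc m → ℓ ∷ map (raise ℓ) (labels m) ↭ labels (suc m)
raise-labels {ℓ} m 1≤ℓ ℓ≤ with m≤n⇒m<n∨m≡n ℓ≤
... | inj₂ refl = ↭-prep ℓ (↭-reflexive (List.map-id-local
  (All.tabulate λ y∈ → raise-below {ℓ} (s≤s (proj₂ (label-bounds m y∈))))))
raise-labels {ℓ} zero    1≤ℓ _ | inj₁ (s≤s ℓ≤0) = contradiction (≤-trans 1≤ℓ ℓ≤0) λ ()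
raise-labels {ℓ} (suc m) 1≤ℓ _ | inj₁ (s≤s ℓ≤m) rewrite raise-above {ℓ} {suc m} ℓ≤m =
  ↭-trans (↭-swap ℓ _ ↭-refl) (↭-prep (suc (suc m)) (raise-labels m 1≤ℓ ℓ≤m))

-- Grafting a new first leaf and its sibling

graft : ℕ → Tree → Tree → Tree
graft a r (leaf v)       = node (leaf a) r v
graft a r (node l r′ x) = node (graft a r l) r′ x

word-graft : ∀ a r t → word (graft a r t) ≡ a ∷ word r ++ word t
word-graft a r (leaf v) = refl
word-graft a r (node l r′ x) rewrite word-graft a r l = cong (a ∷_) (List.++-assoc (word r) (word l) _)

first-graft : ∀ a r t → first (graft a r t) ≡ a
first-graft a r (leaf v)      = refl
first-graft a r (node l r′ x) = first-graft a r l

root-graft : ∀ a r t → root (graft a r t) ≡ root t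
root-graft a r (leaf v)      = refl
root-graft a r (node l r′ x) = refl

-- The first leaf of `t` becomes a node above `leaf a` and `r`, for which the three inequalities are
-- the conditions of `Good`. Higher up, the roots are unchanged, so the old conditions persist.
graft-good : ∀ {a r t} → Good r → Good t → root r < first t → first r < a → a < first t → Good (graft a r t)
graft-good gr leaf r<t r<a a<t = node leaf gr a<t r<t r<a
graft-good {a} {r} gr (node {l} {r′} {x} gl gr′ l<x r′<x r′<l) r<t r<a a<t =
  node (graft-good gr gl r<t r<a a<t) gr′ (subst (_< x) (sym (root-graft a r l)) l<x) r′<x
    (subst (first r′ <_) (sym (root-graft a r l)) r′<l)

node-injective : ∀ {l r x l′ r′ x′} → Tree.node l r x ≡ node l′ r′ x′ → l ≡ l′ × r ≡ r′ × x ≡ x′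
node-injective refl = refl , refl , refl

graft-injective : ∀ {a r r′} t t′ → graft a r t ≡ graft a r′ t′ → r ≡ r′ × t ≡ t′
graft-injective (leaf v) (leaf v′) refl = refl , refl
graft-injective (leaf v) (node (leaf _) _ _) ()
graft-injective (leaf v) (node (node _ _ _) _ _) ()
graft-injective (node (leaf _) _ _) (leaf v) ()
graft-injective (node (node _ _ _) _ _) (leaf v) ()
graft-injective (node l _ _) (node l′ _ _) e with el , refl , refl ← node-injective e
  with refl , refl ← graft-injective l l′ el = refl , refl

-- Descends the left spine to the parent of the first leaf and turns this parent into a leaf.
ungraft : ∀ {l r x} → Good (node l r x) → ∃[ r′ ] ∃[ t ] node l r x ≡ graft (first l) r′ t ×
          Good r′ × Good t × root r′ < first t × first r′ < first l × first l < first t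
ungraft {leaf a} {r} {x} (node _ gr a<x r<x r<a) = r , leaf x , refl , gr , leaf , r<x , r<a , a<x
ungraft {l@(node l₁ l₂ y)} {r} {x} (node gl gr l<x r<x r<l)
  with r′ , t , e , gr′ , gt , c₁ , c₂ , c₃ ← ungraft gl
  with root≡ ← trans (cong root e) (root-graft (first l₁) r′ t)
  = r′ , node t r x , cong (λ l → node l r x) e , gr′ ,
    node gt gr (subst (_< x) root≡ l<x) r<x (subst (first r <_) root≡ r<l) , c₁ , c₂ , c₃

root≢first : ∀ {m a b} → IsPair m (a , b) → root a ≢ first b
root≢first {m} {a} {b} (_ , _ , ab∈) = All.lookup
  (All.lookup (proj₂ (proj₂ (AllPairs-++⁻ (word a) (S⇒unique {m} ab∈)))) (root∈word a)) (first∈word b)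

pair-bounds : ∀ {m a b} → IsPair m (a , b) → root a ≤ m × root b ≤ m × first b ≤ m
pair-bounds {m} {a} {b} (_ , _ , ab∈) =
  bound (∈-++⁺ˡ (root∈word a)) , bound (∈-++⁺ʳ (word a) (root∈word b)) , bound (∈-++⁺ʳ (word a) (first∈word b))
  where
  bound : ∀ {y} → y ∈ word a ++ word b → y ≤ m
  bound y∈ = proj₂ (label-bounds m (∈-resp-↭ (∈S⇒↭ m ab∈) y∈))

-- Counting uniquely sorted words by pairs of good trees

module _ {m} (1≤m : 1 ≤ m) where

  -- The words counted are those of good trees, and `1 ≤ m` excludes a single leaf. It therefore
  -- suffices to match the pairs with trees whose root is a node.
  count-via-pairs : ∀ {P : Word → Set} {Q : Tree × Tree → Set} (P? : Decidable P) (Q? : Decidable Q)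
    (f : Tree × Tree → Tree) →
    (∀ {p} → IsPair m p → Q p → Good (f p) × word (f p) ∈ S (suc m) × P (word (f p))) →
    (∀ {p q} → f p ≡ f q → p ≡ q) →
    (∀ {l r x} → Good (node l r x) → word (node l r x) ∈ S (suc m) → P (word (node l r x)) →
       ∃[ p ] IsPair m p × Q p × f p ≡ node l r x) →
    count (suc m) (λ π → uniquelySorted? (suc m) π ×-dec P? π) ≡ length (filter Q? (pairs m))
  count-via-pairs {P} {Q} P? Q? f to injective onto =
    filter-bijection (λ π → uniquelySorted? (suc m) π ×-dec P? π) Q? (S-unique (suc m)) (pairs-unique m) (word ∘ f)
      (λ p∈ q → let g , w∈ , Pw = to (pairs⇒isPair {m} p∈) q in w∈ , good⇒uniquelySorted {suc m} w∈ g refl , Pw)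
      (λ p∈ q p′∈ q′ e → injective (word-injective
        (proj₁ (to (pairs⇒isPair {m} p∈) q)) (proj₁ (to (pairs⇒isPair {m} p′∈) q′)) e))
      λ π∈ (us , Pπ) → from-good π∈ Pπ (uniquelySorted⇒good {suc m} π∈ (nonempty π∈) us)
    where
    length≡ : ∀ {π} → π ∈ S (suc m) → length π ≡ suc m
    length≡ π∈ = trans (↭-length (∈S⇒↭ (suc m) π∈))
      (trans (List.length-map suc (downFrom (suc m))) (List.length-downFrom (suc m)))
    nonempty : ∀ {π} → π ∈ S (suc m) → π ≢ []
    nonempty π∈ refl with () ← length≡ π∈
    from-good : ∀ {π} → π ∈ S (suc m) → P π → ∃[ t ] Good t × word t ≡ π → ∃[ p ] p ∈ pairs m × Q p × word (f p) ≡ π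
    from-good π∈ Pπ (leaf x , _ , refl) = contradiction (suc-injective (length≡ π∈)) (<⇒≢ 1≤m)
    from-good π∈ Pπ (node l r x , g , refl) with p , ip , q , e ← onto g π∈ Pπ =
      p , isPair⇒pairs {m} ip , q , cong word e

  join-pair : ∀ {a b} → IsPair m (a , b) → first b < root a →
              Good (node a b (suc m)) × word (node a b (suc m)) ∈ S (suc m)
  join-pair {a} {b} ip@(ga , gb , ab∈) b<a with a≤ , b≤ , _ ← pair-bounds {m} ip =
    node ga gb (s≤s a≤) (s≤s b≤) b<a ,
    ↭⇒∈S (suc m) (↭-trans (node-↭ a b (suc m)) (↭-prep (suc m) (∈S⇒↭ m ab∈)))

  split-node : ∀ {l r x} → Good (node l r x) → word (node l r x) ∈ S (suc m) →
               IsPair m (l , r) × first r < root l × suc m ≡ x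
  split-node {l} {r} {x} g@(node gl gr _ _ r<l) w∈ with perm ← ∈S⇒↭ (suc m) w∈
    -- The root bounds all labels, so it is the maximum `suc m`.
    with refl ← ≤-antisym (All.lookup (word≤root g) (∈-resp-↭ (↭-sym perm) (here refl)))
                          (proj₂ (label-bounds (suc m) (∈-resp-↭ perm (root∈word (node l r x)))))
    = (gl , gr , ↭⇒∈S m (drop-∷ (↭-trans (↭-sym (node-↭ l r x)) perm))) , r<l , refl

  count-joins : ∀ {P : Word → Set} {Q : Tree × Tree → Set} (P? : Decidable P) (Q? : Decidable Q) →
    (∀ {l r x} → Good (node l r x) → P (word (node l r x)) ⇔ Q (l , r)) →
    count (suc m) (λ π → uniquelySorted? (suc m) π ×-dec P? π) ≡
    length (filter (λ p → Q? p ×-dec (first (proj₂ p) <? root (proj₁ p))) (pairs m))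
  count-joins P? Q? P⇔Q = count-via-pairs P? _ (λ (a , b) → node a b (suc m))
    (λ ip (q , b<a) → let g , w∈ = join-pair ip b<a in g , w∈ , Equivalence.from (P⇔Q g) q)
    (λ { refl → refl })
    λ { g w∈ Pw → let ip , r<l , e = split-node g w∈ in
        _ , ip , (Equivalence.to (P⇔Q g) Pw , r<l) , cong (node _ _) e }

  -- The conditions of `graft-good` before relabelling: `ℓ ≤ first t` becomes strict once `raise ℓ`
  -- is applied, while `first r < ℓ` is unaffected.
  FitsBelow : ℕ → Tree × Tree → Set
  FitsBelow ℓ (r , t) = first r < ℓ × ℓ ≤ first t × root r < first t

  fitsBelow? : ∀ ℓ → Decidable (FitsBelow ℓ)
  fitsBelow? ℓ (r , t) = (first r <? ℓ) ×-dec (ℓ ≤? first t) ×-dec (root r <? first t)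

  graftRaised : ℕ → Tree × Tree → Tree
  graftRaised ℓ (r , t) = graft ℓ (mapTree (raise ℓ) r) (mapTree (raise ℓ) t)

  word-graftRaised : ∀ ℓ r t → word (graftRaised ℓ (r , t)) ≡ ℓ ∷ map (raise ℓ) (word r ++ word t)
  word-graftRaised ℓ r t = trans (word-graft ℓ _ (mapTree (raise ℓ) t))
    (cong (ℓ ∷_) (trans (cong₂ _++_ (word-mapTree (raise ℓ) r) (word-mapTree (raise ℓ) t))
                        (sym (List.map-++ (raise ℓ) (word r) (word t)))))

  mapTree-lower-raise : ∀ ℓ t → mapTree (lower ℓ) (mapTree (raise ℓ) t) ≡ t
  mapTree-lower-raise ℓ t = trans (mapTree-∘ (lower ℓ) (raise ℓ) t)
    (mapTree-id t (All.tabulate λ {y} _ → lower-raise ℓ y))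

  mapTree-raise-lower : ∀ {ℓ} t → All (ℓ ≢_) (word t) → mapTree (raise ℓ) (mapTree (lower ℓ) t) ≡ t
  mapTree-raise-lower {ℓ} t ℓ∉ = trans (mapTree-∘ (raise ℓ) (lower ℓ) t) (mapTree-id t (All.map raise-lower ℓ∉))

  mapTree-raise-injective : ∀ ℓ {t t′} → mapTree (raise ℓ) t ≡ mapTree (raise ℓ) t′ → t ≡ t′
  mapTree-raise-injective ℓ {t} {t′} e =
    trans (sym (mapTree-lower-raise ℓ t)) (trans (cong (mapTree (lower ℓ)) e) (mapTree-lower-raise ℓ t′))

  graftRaised-good : ∀ {ℓ r t} → IsPair m (r , t) → FitsBelow ℓ (r , t) →
                     Good (graftRaised ℓ (r , t)) × word (graftRaised ℓ (r , t)) ∈ S (suc m)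
  graftRaised-good {ℓ} {r} {t} ip@(gr , gt , rt∈) (r<ℓ , ℓ≤t , r<t) =
    graft-good (mapTree-good (raise-mono-< ℓ) gr) (mapTree-good (raise-mono-< ℓ) gt)
      (subst₂ _<_ (sym (root-mapTree (raise ℓ) r)) (sym (first-mapTree (raise ℓ) t)) (raise-mono-< ℓ r<t))
      (subst (_< ℓ) (sym (first-mapTree (raise ℓ) r)) (Equivalence.from raise<ℓ r<ℓ))
      (subst (ℓ <_) (sym (first-mapTree (raise ℓ) t)) (Equivalence.from ℓ<raise ℓ≤t)) ,
    ↭⇒∈S (suc m) (subst (_↭ labels (suc m)) (sym (word-graftRaised ℓ r t))
      (↭-trans (↭-prep ℓ (↭-map⁺ (raise ℓ) (∈S⇒↭ m rt∈)))
        (raise-labels m (≤-trans (s≤s z≤n) r<ℓ) (m≤n⇒m≤1+n (≤-trans ℓ≤t (proj₂ (proj₂ (pair-bounds {m} ip))))))))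

  graftRaised-good⁻ : ∀ {ℓ r t} → Good (mapTree (raise ℓ) r) → Good (mapTree (raise ℓ) t) →
    root (mapTree (raise ℓ) r) < first (mapTree (raise ℓ) t) → first (mapTree (raise ℓ) r) < ℓ →
    ℓ < first (mapTree (raise ℓ) t) → word (graftRaised ℓ (r , t)) ∈ S (suc m) →
    IsPair m (r , t) × FitsBelow ℓ (r , t)
  graftRaised-good⁻ {ℓ} {r} {t} gr gt r<t r<ℓ ℓ<t w∈ =
    (mapTree-good⁻ r (raise-cancel-< ℓ) gr , mapTree-good⁻ t (raise-cancel-< ℓ) gt ,
     -- Dropping `ℓ` from both sides leaves a permutation between raised words, and `lower ℓ` undoes
     -- the raising.
     ↭⇒∈S m (subst₂ _↭_ (lower-raise-word ℓ _) (lower-raise-word ℓ _) (↭-map⁺ (lower ℓ)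
       (drop-∷ (↭-trans perm (↭-sym (uncurry (raise-labels m) (label-bounds (suc m) (∈-resp-↭ perm (here refl)))))))))) ,
    Equivalence.to raise<ℓ (subst (_< ℓ) (first-mapTree (raise ℓ) r) r<ℓ) ,
    Equivalence.to ℓ<raise (subst (ℓ <_) (first-mapTree (raise ℓ) t) ℓ<t) ,
    raise-cancel-< ℓ (subst₂ _<_ (root-mapTree (raise ℓ) r) (first-mapTree (raise ℓ) t) r<t)
    where
    perm : ℓ ∷ map (raise ℓ) (word r ++ word t) ↭ labels (suc m)
    perm = subst (_↭ labels (suc m)) (word-graftRaised ℓ r t) (∈S⇒↭ (suc m) w∈)

  head⇔first : ∀ {ℓ} t → FirstEntry ℓ (word t) ⇔ first t ≡ ℓ
  head⇔first t = mk⇔ (λ e → Maybe.just-injective (trans (sym (head-word t)) e))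
    (λ e → trans (head-word t) (cong just e))

  count-first-by-grafting : ∀ ℓ →
    count (suc m) (λ π → uniquelySorted? (suc m) π ×-dec firstEntry? ℓ π) ≡ length (filter (fitsBelow? ℓ) (pairs m))
  count-first-by-grafting ℓ = count-via-pairs (firstEntry? ℓ) (fitsBelow? ℓ) (graftRaised ℓ)
    (λ {(r , t)} ip q → let g , w∈ = graftRaised-good ip q in
      g , w∈ , Equivalence.from (head⇔first (graftRaised ℓ (r , t))) (first-graft ℓ _ (mapTree (raise ℓ) t)))
    (λ {(r , t)} {(r′ , t′)} e → let er , et = graft-injective (mapTree (raise ℓ) t) (mapTree (raise ℓ) t′) e in
      cong₂ _,_ (mapTree-raise-injective ℓ er) (mapTree-raise-injective ℓ et))
    onto
    where
    onto : ∀ {l r x} → Good (node l r x) → word (node l r x) ∈ S (suc m) → FirstEntry ℓ (word (node l r x)) →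
           ∃[ p ] IsPair m p × FitsBelow ℓ p × graftRaised ℓ p ≡ node l r x
    onto {l} {r} {x} g w∈ fe with refl ← Equivalence.to (head⇔first (node l r x)) fe
      with r′ , t , e , gr , gt , r<t , r<ℓ , ℓ<t ← ungraft g
      with unique ← subst Unique (trans (cong word e) (word-graft (first l) r′ t)) (S⇒unique {suc m} w∈)
      -- The label `first l` occurs in neither remaining tree, so raising undoes lowering.
      with er ← mapTree-raise-lower r′ (All.++⁻ˡ (word r′) (AP.head unique))
         | et ← mapTree-raise-lower t (All.++⁻ʳ (word r′) (AP.head unique))
      with e′ ← trans (cong₂ (graft (first l)) er et) (sym e)
      with ip , q ← graftRaised-good⁻ {first l} {mapTree (lower (first l)) r′} {mapTree (lower (first l)) t}
             (subst Good (sym er) gr) (subst Good (sym et) gt)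
             (subst₂ (λ r t → root r < first t) (sym er) (sym et) r<t) (subst (λ r → first r < first l) (sym er) r<ℓ)
             (subst (λ t → first l < first t) (sym et) ℓ<t) (subst (λ t → word t ∈ S (suc m)) (sym e′) w∈)
      = _ , ip , q , e′

  count-first-by-joining : ∀ ℓ →
    count (suc m) (λ π → uniquelySorted? (suc m) π ×-dec firstEntry? ℓ π) ≡
    length (filter (λ p → (first (proj₁ p) ≟ ℓ) ×-dec (first (proj₂ p) <? root (proj₁ p))) (pairs m))
  count-first-by-joining ℓ =
    count-joins (firstEntry? ℓ) (λ p → first (proj₁ p) ≟ ℓ) (λ {l} {r} {x} _ → head⇔first (node l r x))

  count-eye : ∀ e →
    count (suc m) (λ π → uniquelySorted? (suc m) π ×-dec hasEye? π e) ≡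
    length (filter (λ p → (first (proj₂ p) ≟ e) ×-dec (first (proj₂ p) <? root (proj₁ p))) (pairs m))
  count-eye e = count-joins (λ π → hasEye? π e) (λ p → first (proj₂ p) ≟ e) (λ g → hasEye⇔ g)

  eye-equidistribution : ∀ w →
    count (suc m) (λ π → uniquelySorted? (suc m) π ×-dec hasEye? π w) ≡
    count (suc m) (λ π → uniquelySorted? (suc m) π ×-dec firstEntry? (suc w) π)
  eye-equidistribution w = begin
    count (suc m) (λ π → uniquelySorted? (suc m) π ×-dec hasEye? π w) ≡⟨ count-eye w ⟩
    -- `N d?` is added on both sides, which states the difference formula without subtraction.
    N eye?                 ≡⟨ +-cancelʳ-≡ (N d?) (N eye?) (N (fitsBelow? (suc w))) (sym balance) ⟩
    N (fitsBelow? (suc w)) ≡⟨ count-first-by-grafting (suc w) ⟨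
    count (suc m) (λ π → uniquelySorted? (suc m) π ×-dec firstEntry? (suc w) π) ∎
    where
    open ≡-Reasoning

    N : ∀ {P : Tree × Tree → Set} → Decidable P → ℕ
    N P? = length (filter P? (pairs m))

    firstˡ? : Decidable (λ p → first (proj₁ p) ≡ w)
    firstˡ? p = first (proj₁ p) ≟ w

    firstʳ? : Decidable (λ p → first (proj₂ p) ≡ w)
    firstʳ? p = first (proj₂ p) ≟ w

    joins? : Decidable (λ p → first (proj₂ p) < root (proj₁ p))
    joins? p = first (proj₂ p) <? root (proj₁ p)

    apart? : Decidable (λ p → root (proj₁ p) < first (proj₂ p))
    apart? p = root (proj₁ p) <? first (proj₂ p)

    eye? : Decidable (λ p → first (proj₂ p) ≡ w × first (proj₂ p) < root (proj₁ p))
    eye? p = firstʳ? p ×-dec joins? p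

    start? : Decidable (λ p → first (proj₁ p) ≡ w × first (proj₂ p) < root (proj₁ p))
    start? p = firstˡ? p ×-dec joins? p

    c? : Decidable (λ p → first (proj₁ p) ≡ w × root (proj₁ p) < first (proj₂ p))
    c? p = firstˡ? p ×-dec apart? p

    d? : Decidable (λ p → first (proj₂ p) ≡ w × root (proj₁ p) < first (proj₂ p))
    d? p = firstʳ? p ×-dec apart? p

    -- The labels of a pair are distinct, so `root a` never equals `first b`.
    apart⇔ : ∀ {p} {X : Set} → p ∈ pairs m →
             (X × ¬ first (proj₂ p) < root (proj₁ p)) ⇔ (X × root (proj₁ p) < first (proj₂ p))
    apart⇔ p∈ = mk⇔ (λ (x , ≮) → x , ≤∧≢⇒< (≮⇒≥ ≮) (root≢first {m} (pairs⇒isPair {m} p∈))) (map₂ <-asym)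

    starts : N firstˡ? ≡ N start? + N c?
    starts = trans (filter-split firstˡ? joins? (pairs m))
      (cong (N start? +_) (filter-cong (λ p → firstˡ? p ×-dec ¬? (joins? p)) c? apart⇔))

    eyes : N firstʳ? ≡ N eye? + N d?
    eyes = trans (filter-split firstʳ? joins? (pairs m))
      (cong (N eye? +_) (filter-cong (λ p → firstʳ? p ×-dec ¬? (joins? p)) d? apart⇔))

    swap-pair : ∀ {p} → p ∈ pairs m → swap p ∈ pairs m
    swap-pair {a , b} p∈ with ga , gb , ab∈ ← pairs⇒isPair {m} p∈ =
      isPair⇒pairs {m} (gb , ga , ∈S-resp-↭ {m} (++-comm (word a) (word b)) ab∈)

    swapped : N firstˡ? ≡ N firstʳ?
    swapped = filter-bijection firstˡ? firstʳ? (pairs-unique m) (pairs-unique m) swap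
      (λ p∈ e → swap-pair p∈ , e) (λ { _ _ _ _ refl → refl }) (λ p∈ e → _ , swap-pair p∈ , e , refl)

    first≤ : ∀ {p} → p ∈ pairs m → first (proj₁ p) ≤ root (proj₁ p)
    first≤ p∈ = first≤root (proj₁ (pairs⇒isPair {m} p∈))

    -- The common part of `FitsBelow w` and `FitsBelow (suc w)`: `first r < w < first t` and
    -- `root r < first t`. Beyond it, `suc w` admits the pairs of `c?`, and `w` those of `d?`.
    below : ℕ
    below = N (λ p → fitsBelow? w p ×-dec ¬? (firstʳ? p))

    fits-suc : N (fitsBelow? (suc w)) ≡ N c? + below
    fits-suc = trans (filter-split (fitsBelow? (suc w)) firstˡ? (pairs m)) (cong₂ _+_
      (filter-cong (λ p → fitsBelow? (suc w) p ×-dec firstˡ? p) c? λ p∈ → mk⇔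
        (λ ((_ , _ , r<t) , e) → e , r<t)
        λ { (refl , r<t) → (≤-refl , ≤-<-trans (first≤ p∈) r<t , r<t) , refl })
      (filter-cong (λ p → fitsBelow? (suc w) p ×-dec ¬? (firstˡ? p))
                   (λ p → fitsBelow? w p ×-dec ¬? (firstʳ? p)) {pairs m} λ p∈ → mk⇔
        (λ ((r<ℓ , ℓ≤t , r<t) , ≢) → (≤∧≢⇒< (≤-pred r<ℓ) ≢ , <⇒≤ ℓ≤t , r<t) , <⇒≢ ℓ≤t ∘ sym)
        (λ ((r<w , w≤t , r<t) , ≢) → (m≤n⇒m≤1+n r<w , ≤∧≢⇒< w≤t (≢ ∘ sym) , r<t) , <⇒≢ r<w)))

    fits : N (fitsBelow? w) ≡ N d? + below
    fits = trans (filter-split (fitsBelow? w) firstʳ? (pairs m)) (cong (_+ below)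
      (filter-cong (λ p → fitsBelow? w p ×-dec firstʳ? p) d? λ p∈ → mk⇔
        (λ ((_ , _ , r<t) , e) → e , r<t)
        λ { (refl , r<t) → (≤-<-trans (first≤ p∈) r<t , ≤-refl , r<t) , refl }))

    balance : N (fitsBelow? (suc w)) + N d? ≡ N eye? + N d?
    balance = begin
      N (fitsBelow? (suc w)) + N d?  ≡⟨ cong (_+ N d?) fits-suc ⟩
      (N c? + below) + N d?          ≡⟨ trans (+-assoc (N c?) below _) (cong (N c? +_) (+-comm below _)) ⟩
      N c? + (N d? + below)          ≡⟨ cong (N c? +_) fits ⟨
      -- Grafting and joining count the same words, those with first entry `w`.
      N c? + N (fitsBelow? w)        ≡⟨ cong (N c? +_)
        (trans (sym (count-first-by-grafting w)) (count-first-by-joining w)) ⟩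
      N c? + N start?                ≡⟨ +-comm (N c?) _ ⟩
      N start? + N c?                ≡⟨ trans (sym starts) (trans swapped eyes) ⟩
      N eye? + N d?                  ∎

theorem5p8 : (k ℓ : ℕ) → 1 ≤ k → 1 ≤ ℓ → ℓ ≤ 2 * k + 1 →
    count (2 * k + 1) (λ π → uniquelySorted? (2 * k + 1) π ×-dec hasEye? π (ℓ ∸ 1)) ≡ A (suc k) ℓ
-- Here `ℓ` is `suc w`, so the eye is `w`. Writing the size as `suc (2 * k)` gives `m = 2 * k`, the
-- number of labels shared by the two trees of a pair.
theorem5p8 k (suc w) 1≤k _ _ rewrite +-comm (2 * k) 1 = eye-equidistribution (≤-trans 1≤k (m≤n*m k 2)) w
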